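{- Let $k\geqslant 1$ and let $n,r$ be integers with $2\leqslant r\leqslant n-1$. Then $$|\mathcal{E}_{n,k}^{r-1}[n\prec 1]|=(kn-2n+r)\,|\mathcal{E}_{n,k}^{r}[n\prec 1]|.$$
   Context: A $k$-edge colored tree is a (labeled, non-plane) tree whose edges are colored from a set of $k$ colors $\{\mathbf{1},\mathbf{2},\ldots,\mathbf{k}\}$ such that any two edges with a common vertex have different colors. A special $k$-edge colored tree is a rooted $k$-edge colored tree such that all edges joining the root to its children are colored with the first $k-1$ colors $\{\mathbf{1},\ldots,\mathbf{k-1}\}$. $\mathcal{E}_{n,k}^{r}$ denotes the set of forests with vertex set $[n]=\{1,\ldots,n\}$ consisting of exactly $r$ special $k$-edge colored trees whose roots are $1,\ldots,r$ respectively. A vertex $y$ of a forest is a descendant of $x$, written $y\prec x$, if $x$ lies on the path from the root of the tree containing $y$ to $y$. $\mathcal{E}_{n,k}^{r}[n\prec 1]$ denotes the subset of those forests in $\mathcal{E}_{n,k}^{r}$ in which $n\prec 1$, i.e. vertex $n$ lies in the tree rooted at $1$. -}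

module Defs where

open import Data.Nat using (ℕ; suc; _≤_; _∸_)
open import Data.Fin using (Fin; toℕ)
open import Data.List using (List; []; _∷_; length)
open import Data.List.Membership.Propositional using (_∈_)
open import Data.List.Relation.Unary.Unique.Propositional using (Unique)
open import Data.Maybe using (Maybe; just; nothing)
open import Data.Product using (Σ; ∃; ∃-syntax; ∃!; _×_; proj₁)
open import Function.Bundles using (Inverse)
open import Level using (0ℓ)
open import Relation.Binary.Bundles using (Setoid)
open import Relation.Binary.Construct.Closure.ReflexiveTransitive using (Star; ε; _◅_)
import Relation.Binary.Construct.On as On
open import Relation.Binary.PropositionalEquality using (_≡_; refl; sym; trans; setoid)
open import Relation.Nullary using (¬_)

-- Vertices and colours are elements of Fin m, standing for {1, …, m}.
label : ∀ {m} → Fin m → ℕ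
label i = suc (toℕ i)

-- A finite simple graph on [n] with edges properly coloured by [k]:
-- colour x y is nothing when xy is not an edge.
record ColouredGraph (n k : ℕ) : Set where
  field
    colour        : Fin n → Fin n → Maybe (Fin k)
    colour-sym    : ∀ x y → colour x y ≡ colour y x
    colour-irrefl : ∀ x → colour x x ≡ nothing
    colour-proper : ∀ {x y z c} → colour x y ≡ just c → colour x z ≡ just c → y ≡ z

  Adj : Fin n → Fin n → Set
  Adj x y = ∃[ c ] colour x y ≡ just c

  Walk : Fin n → Fin n → Set
  Walk = Star Adj

  vertices : ∀ {x y} → Walk x y → List (Fin n)
  vertices {x} ε       = x ∷ []
  vertices {x} (_ ◅ w) = x ∷ vertices w

  IsPath : ∀ {x y} → Walk x y → Set
  IsPath w = Unique (vertices w)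

  -- A cycle is a path on at least three vertices whose ends are adjacent.
  Acyclic : Set
  Acyclic = ∀ {x y} (w : Walk x y) → IsPath w → 3 ≤ length (vertices w) → ¬ Adj y x

-- Forests of r special k-edge coloured trees on [n] with roots 1, …, r (r ≤ n).
-- The components of an acyclic graph are its trees, so `rooted` says that
-- each tree contains exactly one of the vertices 1, …, r.
record SpecialForest (n k r : ℕ) : Set where
  field
    graph : ColouredGraph n k
  open ColouredGraph graph public

  IsRoot : Fin n → Set
  IsRoot x = label x ≤ r

  field
    acyclic : Acyclic
    rooted  : ∀ y → ∃! _≡_ λ x → IsRoot x × Walk x y
    special : ∀ {x y c} → IsRoot x → colour x y ≡ just c → label c ≤ k ∸ 1

  infix 4 _≺_
  _≺_ : Fin n → Fin n → Set
  y ≺ x = ∃[ ρ ] Σ (Walk ρ y) λ w → IsRoot ρ × IsPath w × x ∈ vertices w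

-- Two forests are equal when they have the same edges with the same colours.
𝓔 : (n k r : ℕ) → Setoid 0ℓ 0ℓ
𝓔 n k r = record
  { Carrier       = SpecialForest n k r
  ; _≈_           = λ F G → ∀ x y → colour F x y ≡ colour G x y
  ; isEquivalence = record
    { refl  = λ x y → refl
    ; sym   = λ F≈G x y → sym (F≈G x y)
    ; trans = λ F≈G G≈H x y → trans (F≈G x y) (G≈H x y)
    }
  }
  where open SpecialForest

n≺1 : ∀ {n k r} → SpecialForest n k r → Set
n≺1 {n} F = ∃[ y ] ∃[ x ] label y ≡ n × label x ≡ 1 × y ≺ x
  where open SpecialForest F

𝓔[n≺1] : (n k r : ℕ) → Setoid 0ℓ 0ℓ
𝓔[n≺1] n k r = On.setoid {B = Σ (SpecialForest n k r) n≺1} (𝓔 n k r) proj₁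

HasCardinality : Setoid 0ℓ 0ℓ → ℕ → Set
HasCardinality S m = Inverse S (setoid (Fin m))

{-# OPTIONS --safe #-}
module Submission where

-- Let s = r − 1 and let ρ be the vertex r. Cutting the edge above ρ turns a forest with roots 1, …, s into one
-- with roots 1, …, r together with the cut half-edge (x, c) outside the tree of ρ; after exchanging the colours
-- c and k in the tree of ρ this forest is special, and the process is a bijection. If n ≺ ρ ≺ 1 before the cut,
-- then exchanging the roots 1 and ρ afterwards gives a forest with n ≺ 1 in which x lies in the tree of ρ, which
-- is exactly the case missing so far. So the forests with one root less correspond to pairs of a forest with
-- n ≺ 1 and an arbitrary free half-edge, and every forest with r roots has kn − r − 2(n − r) of those.

import Data.Nat as ℕ
open import Data.Nat using (ℕ; zero; suc; _≤_; _<_; _∸_; z≤n; s≤s)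
import Data.Nat.Properties as ℕₚ
import Data.Nat.Solver as ℕ-Solver
import Data.Integer.Properties as ℤₚ
import Data.Integer.Solver as ℤ-Solver
open import Data.Integer using (+_; _+_; _-_; _*_)
open import Data.Fin using (Fin; zero; suc; toℕ; fromℕ; fromℕ<; inject₁)
open import Data.Fin.Properties using (_≟_; suc-injective; *↔×; all?; toℕ-inject₁; fromℕ<-cong; fromℕ<-injective;
  toℕ-fromℕ; toℕ-fromℕ<; toℕ-injective; toℕ<n)
open import Data.Fin.Permutation using (↔⇒≡)
open import Data.Fin.Permutation.Components using (transpose)
open import Data.List using (_∷_; length; map)
open import Data.List.Properties using (length-map)
open import Data.List.Membership.Propositional using (_∈_; _∉_)
open import Data.List.Relation.Unary.Any using (here; there)
open import Data.List.Relation.Unary.All.Properties using (¬Any⇒All¬; All¬⇒¬Any)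
open import Data.List.Relation.Unary.All using ([])
open import Data.List.Relation.Unary.AllPairs using ([]; _∷_)
open import Data.List.Relation.Unary.Unique.Propositional using (Unique)
import Data.List.Relation.Unary.Unique.Propositional.Properties as Unique
import Data.List.Membership.DecPropositional as DecMembership
open import Data.Maybe using (Maybe; just; nothing)
import Data.Maybe as Maybe
open import Data.Maybe.Properties using (just-injective; map-injective) renaming (≡-dec to Maybe-≡-dec)
open import Data.Product using (Σ; ∃-syntax; Σ-syntax; ∃!; _×_; _,_; proj₁; proj₂; uncurry)
open import Data.Product.Properties using (≡-dec)
open import Data.Product.Relation.Binary.Pointwise.NonDependent using (×-setoid; Pointwise-≡↔≡)
open import Data.Product.Function.NonDependent.Setoid using (_×-inverse_)
open import Data.Sum using (_⊎_; inj₁; inj₂; [_,_]′)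
open import Data.Empty using (⊥; ⊥-elim)
open import Function using (_∘_; id; case_of_)
open import Function.Bundles using (Inverse)
import Function.Construct.Composition as Composition
import Function.Construct.Identity as Identity
import Function.Construct.Symmetry as Symmetry
open import Level using (0ℓ)
open import Relation.Binary.Bundles using (Setoid)
open import Relation.Binary.Construct.Closure.ReflexiveTransitive using (ε; _◅_; _◅◅_; reverse; gmap)
import Relation.Binary.Construct.On as On
open import Relation.Binary.PropositionalEquality using (_≡_; _≢_; refl; sym; trans; cong; cong₂; subst;
  setoid; module ≡-Reasoning)
open import Relation.Nullary using (¬_; Dec; yes; no; contradiction)
open import Relation.Nullary.Decidable using (_×-dec_; _⊎-dec_; _→-dec_; ¬?; map′; dec-true; dec-false; toSum)
open import Defs

-- Finite setoids

-- The number of free half-edges is not taken from a degree sum but from the cut itself. Joining ρ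
-- to x occupies two half-edges, but ρ ceases to be a root and gains the colour withheld from it; so
-- the number falls by exactly one with each root lost, starting from the edgeless forest, in which
-- all n vertices are roots. The same recursion shows that the sets of forests are finite, so graphs
-- are never enumerated.
--
-- Forests are compared by their colours alone and carry proofs that need not agree, hence all
-- bijections are between setoids. The set of free half-edges varies with the forest and only its
-- size is constant, so the product at the end counts a family of fibres. Its second factor is a
-- natural number only where a forest exists: with a single colour and r < n the coefficient of the
-- theorem is negative, and there are no forests.

infixr 9 _∘↔_

_∘↔_ : {S T U : Setoid 0ℓ 0ℓ} → Inverse T U → Inverse S T → Inverse S U
g ∘↔ f = Composition.inverse f g

Sub : (S : Setoid 0ℓ 0ℓ) → (Setoid.Carrier S → Set) → Setoid 0ℓ 0ℓ
Sub S P = On.setoid {B = Σ (Setoid.Carrier S) P} S proj₁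

-- Reflecting equality supplies both the congruence of `g` and the second inverse law. This matters
-- for `cut`, whose result is read off a chosen path and is hard to compare directly for two equal
-- forests.
bijection⇒Inverse : {S T : Setoid 0ℓ 0ℓ} →
  let open Setoid S renaming (Carrier to A; _≈_ to _≈₁_)
      open Setoid T renaming (Carrier to B; _≈_ to _≈₂_) in
  (f : A → B) (g : B → A) →
  (∀ {x y} → x ≈₁ y → f x ≈₂ f y) → (∀ {x y} → f x ≈₂ f y → x ≈₁ y) →
  (∀ y → f (g y) ≈₂ y) → Inverse S T
bijection⇒Inverse {S} {T} f g f-cong f-inj fg = record
  { to = f ; from = g ; to-cong = f-cong
  ; from-cong = λ {x} {y} x≈y → f-inj (T.trans (fg x) (T.trans x≈y (T.sym (fg y))))
  ; inverse = (λ {x} y≈gx → T.trans (f-cong y≈gx) (fg x))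
            , (λ {x} {y} y≈fx → f-inj (T.trans (fg y) y≈fx)) }
  where module S = Setoid S
        module T = Setoid T

Sub-cong : {S T : Setoid 0ℓ 0ℓ} →
  let open Setoid S renaming (Carrier to A)
      open Setoid T renaming (Carrier to B; _≈_ to _≈₂_) in
  (i : Inverse S T) {P : A → Set} {Q : B → Set} →
  (∀ x → P x → Q (Inverse.to i x)) → (∀ x → Q (Inverse.to i x) → P x) →
  (∀ {x y} → x ≈₂ y → Q x → Q y) → Inverse (Sub S P) (Sub T Q)
Sub-cong {S} {T} i P⇒Q Q⇒P Q-resp = record
  { to = λ (x , p) → I.to x , P⇒Q x p
  ; from = λ (y , q) → I.from y , Q⇒P (I.from y) (Q-resp (Setoid.sym T (I.strictlyInverseˡ y)) q)
  ; to-cong = I.to-cong ; from-cong = I.from-cong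
  ; inverse = I.inverseˡ , I.inverseʳ }
  where module I = Inverse i

Sub-Fin-finite : ∀ m {P : Fin m → Set} → (∀ i → Dec (P i)) →
  ∃[ c ] HasCardinality (Sub (setoid (Fin m)) P) c
Sub-Fin-finite zero P? = 0 , record
  { to = λ () ; from = λ () ; to-cong = λ { {()} } ; from-cong = λ { {()} }
  ; inverse = (λ { {()} }) , (λ { {()} }) }
Sub-Fin-finite (suc m) {P} P? with P? zero | Sub-Fin-finite m (P? ∘ suc)
... | yes p0 | c , i = suc c , bijection⇒Inverse f g f-cong f-inj fg
  where
    module I = Inverse i
    f : Σ (Fin (suc m)) P → Fin (suc c)
    f (zero , _)  = zero
    f (suc j , p) = suc (I.to (j , p))
    g : Fin (suc c) → Σ (Fin (suc m)) P
    g zero    = zero , p0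
    g (suc j) = suc (proj₁ (I.from j)) , proj₂ (I.from j)
    f-cong : ∀ {x y} → proj₁ x ≡ proj₁ y → f x ≡ f y
    f-cong {zero , _}  {zero , _}   _    = refl
    f-cong {suc _ , _} {suc _ , _} refl = cong suc (I.to-cong refl)
    f-inj : ∀ {x y} → f x ≡ f y → proj₁ x ≡ proj₁ y
    f-inj {zero , _}  {zero , _}  _  = refl
    f-inj {suc _ , _} {suc _ , p} eq =
      cong suc (trans (sym (I.inverseʳ (sym (suc-injective eq)))) (I.strictlyInverseʳ (_ , p)))
    fg : ∀ y → f (g y) ≡ y
    fg zero    = refl
    fg (suc j) = cong suc (I.strictlyInverseˡ j)
... | no ¬p0 | c , i = c , bijection⇒Inverse f g f-cong f-inj I.strictlyInverseˡ
  where
    module I = Inverse i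
    f : Σ (Fin (suc m)) P → Fin c
    f (zero , p)  = ⊥-elim (¬p0 p)
    f (suc j , p) = I.to (j , p)
    g : Fin c → Σ (Fin (suc m)) P
    g j = suc (proj₁ (I.from j)) , proj₂ (I.from j)
    f-cong : ∀ {x y} → proj₁ x ≡ proj₁ y → f x ≡ f y
    f-cong {zero , p}  {_}         _    = ⊥-elim (¬p0 p)
    f-cong {suc _ , _} {suc _ , _} refl = I.to-cong refl
    f-inj : ∀ {x y} → f x ≡ f y → proj₁ x ≡ proj₁ y
    f-inj {zero , p}  {_}         _  = ⊥-elim (¬p0 p)
    f-inj {suc _ , _} {zero , p}  _  = ⊥-elim (¬p0 p)
    f-inj {suc _ , _} {suc _ , p} eq =
      cong suc (trans (sym (I.inverseʳ (sym eq))) (I.strictlyInverseʳ (_ , p)))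

Sub-finite : ∀ {S m} → let open Setoid S in HasCardinality S m → {P : Carrier → Set} →
  (∀ x → Dec (P x)) → (∀ {x y} → x ≈ y → P x → P y) → ∃[ c ] HasCardinality (Sub S P) c
Sub-finite {S} {m} i {P} P? P-resp with Sub-Fin-finite m (P? ∘ Inverse.from i)
... | c , j = c , j ∘↔ Sub-cong i (λ x → P-resp (S.sym (I.strictlyInverseʳ x)))
                              (λ x → P-resp (I.strictlyInverseʳ x)) (λ { refl p → p })
  where module I = Inverse i
        module S = Setoid S

-- Transporting along representatives I.from (I.to s) makes the fibre bijections coherent.
Sub-×-cardinality : ∀ {S : Setoid 0ℓ 0ℓ} {C : Set} {b N} → let open Setoid S in
  {P : Carrier → C → Set} →
  HasCardinality S b → (∀ {x y c} → x ≈ y → P x c → P y c) →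
  (∀ x → HasCardinality (Sub (setoid C) (P x)) N) →
  HasCardinality (Sub (×-setoid S (setoid C)) (uncurry P)) (b ℕ.* N)
Sub-×-cardinality {S} {C} {b} {N} {P} i P-resp fibre = Symmetry.inverse *↔× ∘↔ bijection⇒Inverse f g f-cong f-inj fg
  where
    open Setoid S renaming (sym to ≈-sym; trans to ≈-trans; refl to ≈-refl) hiding (reflexive)
    module I = Inverse i
    module E j = Inverse (fibre (I.from j))
    f : Σ (Carrier × C) (uncurry P) → Fin b × Fin N
    f ((x , c) , p) = I.to x , E.to (I.to x) (c , P-resp (≈-sym (I.strictlyInverseʳ x)) p)
    g : Fin b × Fin N → Σ (Carrier × C) (uncurry P)
    g (j , l) = (I.from j , proj₁ (E.from j l)) , proj₂ (E.from j l)
    E-cong : ∀ {j j′ : Fin b} {c c′ p p′} → j ≡ j′ → c ≡ c′ → E.to j (c , p) ≡ E.to j′ (c′ , p′)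
    E-cong refl refl = E.to-cong _ refl
    f-cong : ∀ {u v} → Setoid._≈_ (Sub (×-setoid S (setoid C)) (uncurry P)) u v → f u ≡ f v
    f-cong (x≈y , c≡d) = cong₂ _,_ (I.to-cong x≈y) (E-cong (I.to-cong x≈y) c≡d)
    E-inj : ∀ {j j′ : Fin b} {c c′ p p′} → j ≡ j′ → E.to j (c , p) ≡ E.to j′ (c′ , p′) → c ≡ c′
    E-inj {j} {c′ = c′} {p′ = p′} refl eq = trans (sym (E.inverseʳ j (sym eq))) (E.strictlyInverseʳ j (c′ , p′))
    f-inj : ∀ {u v} → f u ≡ f v → Setoid._≈_ (Sub (×-setoid S (setoid C)) (uncurry P)) u v
    f-inj {(x , _) , _} {(y , _) , _} eq =
      ≈-trans (≈-sym (I.strictlyInverseʳ x)) (≈-trans (I.from-cong (cong proj₁ eq)) (I.strictlyInverseʳ y)) ,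
      E-inj (cong proj₁ eq) (cong proj₂ eq)
    fg : ∀ y → f (g y) ≡ y
    fg (j , l) = cong₂ _,_ (I.strictlyInverseˡ j)
      (trans (E-cong (I.strictlyInverseˡ j) refl) (E.strictlyInverseˡ j l))

-- Meant for one joining step: `P` holds the half-edges free before it, `Q` those free after it,
-- `x₀` is the one used up and `f` the colour exchange. Being an involution, `f` serves in both
-- directions.
Sub-insert-cardinality : ∀ {C : Set} {N} {P Q : C → Set} (_≟C_ : (x y : C) → Dec (x ≡ y))
  (f : C → C) → (∀ x → f (f x) ≡ x) → (x₀ : C) → P x₀ →
  (∀ x → P x → x ≢ x₀ → Q (f x)) → (∀ x → Q x → P (f x) × f x ≢ x₀) →
  HasCardinality (Sub (setoid C) Q) N → HasCardinality (Sub (setoid C) P) (suc N)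
Sub-insert-cardinality {C} {N} {P} {Q} _≟C_ f ff x₀ p₀ P⇒Q Q⇒P i =
  bijection⇒Inverse (uncurry h) g h-cong h-inj hg
  where
    module I = Inverse i
    h : (x : C) → P x → Fin (suc N)
    h x p with x ≟C x₀
    ... | yes _ = zero
    ... | no x≢ = suc (I.to (f x , P⇒Q x p x≢))
    g : Fin (suc N) → Σ C P
    g zero    = x₀ , p₀
    g (suc j) = f (proj₁ (I.from j)) , proj₁ (Q⇒P _ (proj₂ (I.from j)))
    h-cong : ∀ {u v : Σ C P} → proj₁ u ≡ proj₁ v → uncurry h u ≡ uncurry h v
    h-cong {x , _} refl with x ≟C x₀
    ... | yes _ = refl
    ... | no _  = cong suc (I.to-cong refl)
    h-inj : ∀ {u v : Σ C P} → uncurry h u ≡ uncurry h v → proj₁ u ≡ proj₁ v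
    h-inj {x , _} {y , q} eq with x ≟C x₀ | y ≟C x₀
    ... | yes refl | yes refl = refl
    ... | no _     | no y≢    = trans (sym (ff x)) (trans (cong f (trans
            (sym (I.inverseʳ (sym (suc-injective eq)))) (I.strictlyInverseʳ (_ , P⇒Q y q y≢)))) (ff y))
    h-inj () | yes _ | no _
    h-inj () | no _ | yes _
    hg : ∀ j → uncurry h (g j) ≡ j
    hg zero with x₀ ≟C x₀
    ... | yes _ = refl
    ... | no x≢ = contradiction refl x≢
    hg (suc j) with f (proj₁ (I.from j)) ≟C x₀
    ... | yes eq = contradiction eq (proj₂ (Q⇒P _ (proj₂ (I.from j))))
    ... | no _   = cong suc (trans (I.to-cong (ff _)) (I.strictlyInverseˡ j))

-- Colour maps, transpositions and functions altered at one edge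

map-just : ∀ {A B : Set} (σ : A → B) m {d} → Maybe.map σ m ≡ just d → ∃[ c ] m ≡ just c × σ c ≡ d
map-just σ (just c) refl = c , refl , refl

transpose-left : ∀ {m} (i j : Fin m) → transpose i j i ≡ j
transpose-left i j rewrite dec-true (i ≟ i) refl = refl

transpose-right : ∀ {m} (i j : Fin m) → transpose i j j ≡ i
transpose-right i j with j ≟ i
... | yes refl = refl
... | no _ rewrite dec-true (j ≟ j) refl = refl

transpose-other : ∀ {m} (i j : Fin m) {l} → l ≢ i → l ≢ j → transpose i j l ≡ l
transpose-other i j {l} l≢i l≢j rewrite dec-false (l ≟ i) l≢i | dec-false (l ≟ j) l≢j = refl

transpose-involutive : ∀ {m} (i j l : Fin m) → transpose i j (transpose i j l) ≡ l
transpose-involutive i j l = go (l ≟ i) (l ≟ j)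
  where
    go : ∀ {l} → Dec (l ≡ i) → Dec (l ≡ j) → transpose i j (transpose i j l) ≡ l
    go (yes refl) _        = trans (cong (transpose i j) (transpose-left i j)) (transpose-right i j)
    go (no _) (yes refl)   = trans (cong (transpose i j) (transpose-right i j)) (transpose-left i j)
    go (no l≢i) (no l≢j)   = trans (cong (transpose i j) eq) eq
      where eq = transpose-other i j l≢i l≢j

involutive⇒injective : ∀ {A : Set} (f : A → A) → (∀ x → f (f x) ≡ x) → ∀ {x y} → f x ≡ f y → x ≡ y
involutive⇒injective f ff eq = trans (sym (ff _)) (trans (cong f eq) (ff _))

IsEdge : ∀ {n} → (p q a b : Fin n) → Set
IsEdge p q a b = (a ≡ p × b ≡ q) ⊎ (a ≡ q × b ≡ p)

isEdge? : ∀ {n} (p q a b : Fin n) → Dec (IsEdge p q a b)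
isEdge? p q a b = (a ≟ p ×-dec b ≟ q) ⊎-dec (a ≟ q ×-dec b ≟ p)

IsEdge-sym : ∀ {n} {p q a b : Fin n} → IsEdge p q a b → IsEdge p q b a
IsEdge-sym (inj₁ (e , e′)) = inj₂ (e′ , e)
IsEdge-sym (inj₂ (e , e′)) = inj₁ (e′ , e)

override : ∀ {n} {A : Set} (p q : Fin n) → A → (Fin n → Fin n → A) → Fin n → Fin n → A
override p q m f a b with isEdge? p q a b
... | yes _ = m
... | no _  = f a b

override-edge : ∀ {n} {A : Set} {p q : Fin n} (m : A) f {a b} → IsEdge p q a b → override p q m f a b ≡ m
override-edge {p = p} {q} m f {a} {b} e with isEdge? p q a b
... | yes _ = refl
... | no ¬e = contradiction e ¬e

override-other : ∀ {n} {A : Set} {p q : Fin n} (m : A) f {a b} → ¬ IsEdge p q a b → override p q m f a b ≡ f a b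
override-other {p = p} {q} m f {a} {b} ¬e with isEdge? p q a b
... | yes e = contradiction e ¬e
... | no _  = refl

override-cong : ∀ {n} {A : Set} (p q : Fin n) (m : A) {f g} → (∀ a b → f a b ≡ g a b) →
  ∀ a b → override p q m f a b ≡ override p q m g a b
override-cong p q m f≗g a b with isEdge? p q a b
... | yes _ = refl
... | no _  = f≗g a b

-- Walks and paths

module _ {n k : ℕ} where

  open DecMembership (_≟_ {n}) using (_∈?_)
  open ColouredGraph using (Adj; Walk; vertices; IsPath; colour; Acyclic)

  Adj-sym : (G : ColouredGraph n k) → ∀ {a b} → Adj G a b → Adj G b a
  Adj-sym G (c , eq) = c , trans (ColouredGraph.colour-sym G _ _) eq

  reverseWalk : (G : ColouredGraph n k) → ∀ {a b} → Walk G a b → Walk G b a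
  reverseWalk G = reverse (Adj-sym G)

  vertices-nonempty : (G : ColouredGraph n k) → ∀ {a b} (w : Walk G a b) → 1 ≤ length (vertices G w)
  vertices-nonempty G ε       = s≤s z≤n
  vertices-nonempty G (_ ◅ _) = s≤s z≤n

  end∈vertices : (G : ColouredGraph n k) → ∀ {a b} (w : Walk G a b) → b ∈ vertices G w
  end∈vertices G ε       = here refl
  end∈vertices G (_ ◅ w) = there (end∈vertices G w)

  start∈vertices : (G : ColouredGraph n k) → ∀ {a b} (w : Walk G a b) → a ∈ vertices G w
  start∈vertices G ε       = here refl
  start∈vertices G (_ ◅ _) = here refl

  prefix : (G : ColouredGraph n k) → ∀ {a b c} (w : Walk G a b) → c ∈ vertices G w → Walk G a c
  prefix G ε       (here refl) = ε
  prefix G (_ ◅ _) (here refl) = ε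
  prefix G (e ◅ w) (there c∈)  = e ◅ prefix G w c∈

  Path : (G : ColouredGraph n k) → Fin n → Fin n → Set
  Path G a b = Σ (Walk G a b) (IsPath G)

  suffix : (G : ColouredGraph n k) → ∀ {a b c} (w : Walk G a b) → IsPath G w → c ∈ vertices G w → Path G c b
  suffix G ε       u       (here refl) = ε , u
  suffix G (e ◅ w) u       (here refl) = e ◅ w , u
  suffix G (e ◅ w) (_ ∷ u) (there c∈)  = suffix G w u c∈

  walk⇒path : (G : ColouredGraph n k) → ∀ {a b} → Walk G a b → Path G a b
  walk⇒path G ε = ε , [] ∷ []
  walk⇒path G {a} (e ◅ w) with walk⇒path G w
  ... | p , u with a ∈? vertices G p
  ...   | yes a∈ = suffix G p u a∈
  ...   | no a∉  = e ◅ p , ¬Any⇒All¬ _ a∉ ∷ u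

  cons-path : (G : ColouredGraph n k) → ∀ {a b c} {e : Adj G a b} {w : Walk G b c} →
    IsPath G (e ◅ w) → a ∉ vertices G w × IsPath G w
  cons-path G (a∉ ∷ u) = All¬⇒¬Any a∉ , u

  -- A path that returns to its start is trivial. The extra `suc` accounts for a preceding step
  -- along the very edge that would close the cycle.
  closed-path-short : (G : ColouredGraph n k) → ∀ {a} (w : Walk G a a) → IsPath G w →
    ¬ (3 ≤ suc (length (vertices G w)))
  closed-path-short G ε       _ (s≤s (s≤s ()))
  closed-path-short G (e ◅ w) u _ = contradiction (end∈vertices G w) (proj₁ (cons-path G {e = e} {w = w} u))

  -- Applied to a walk from `ρ` to its root, this finds the parent of `ρ`. The remaining walk avoids
  -- `ρ`, so it survives when the edge to the parent is deleted.
  first-step : (G : ColouredGraph n k) → ∀ {a b} → a ≢ b → Walk G a b →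
    ∃[ x ] ∃[ c ] colour G a x ≡ just c × Σ[ w ∈ Walk G x b ] a ∉ vertices G w
  first-step G {a} {b} a≢b w with walk⇒path G w
  ... | ε , _               = contradiction refl a≢b
  ... | (c , eq) ◅ w′ , u = _ , c , eq , w′ , proj₁ (cons-path G {e = c , eq} {w = w′} u)

  gmap-vertices : (G H : ColouredGraph n k) (f : Fin n → Fin n) (h : ∀ {a b} → Adj G a b → Adj H (f a) (f b)) →
    ∀ {a b} (w : Walk G a b) → vertices H (gmap f h w) ≡ map f (vertices G w)
  gmap-vertices G H f h ε       = refl
  gmap-vertices G H f h (_ ◅ w) = cong (_ ∷_) (gmap-vertices G H f h w)

  -- An injective map keeps the vertices of a path distinct and their number the same, so a cycle of
  -- `G` would give one of `H`. With `f = id` this handles subgraphs.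
  Acyclic-pullback : (G H : ColouredGraph n k) (f : Fin n → Fin n) → (∀ {a b} → f a ≡ f b → a ≡ b) →
    (∀ {a b} → Adj G a b → Adj H (f a) (f b)) → Acyclic H → Acyclic G
  Acyclic-pullback G H f f-inj h acyc w u 3≤ e =
    acyc (gmap f h w) (subst Unique (sym eq) (Unique.map⁺ f-inj u))
         (subst (3 ≤_) (sym (trans (cong length eq) (length-map f (vertices G w)))) 3≤) (h e)
    where eq = gmap-vertices G H f h w

  Lifted : (G H : ColouredGraph n k) → ∀ {a b} → Walk G a b → Set
  Lifted G H {a} {b} w = Σ[ w′ ∈ Walk H a b ] vertices H w′ ≡ vertices G w

  lift : (G H : ColouredGraph n k) → (∀ {a b} → Adj G a b → Adj H a b) → ∀ {a b} (w : Walk G a b) → Lifted G H w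
  lift G H h ε = ε , refl
  lift G H h (e ◅ w) with lift G H h w
  ... | w′ , eq = h e ◅ w′ , cong (_ ∷_) eq

  -- For graphs that differ in a single edge: with `z` one of its ends, a walk that avoids `z` never
  -- uses that edge.
  lift-avoiding : (G H : ColouredGraph n k) (z : Fin n) → (∀ {a b} → a ≢ z → b ≢ z → Adj G a b → Adj H a b) →
    ∀ {a b} (w : Walk G a b) → z ∉ vertices G w → Lifted G H w
  lift-avoiding G H z h ε       z∉ = ε , refl
  lift-avoiding G H z h (e ◅ w) z∉ with lift-avoiding G H z h w (z∉ ∘ there)
  ... | w′ , eq = h (λ { refl → z∉ (here refl) }) (λ { refl → z∉ (there (start∈vertices G w)) }) e ◅ w′ , cong (_ ∷_) eq

  -- Rooted graphs

  RootedBy : (Fin n → Set) → ColouredGraph n k → Set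
  RootedBy R G = ∀ y → ∃! _≡_ λ x → R x × Walk G x y

  -- A map that is constant along edges is constant on trees; as it fixes the roots, every root of
  -- the tree of `y` equals `f y`.
  rootedBy : {R : Fin n → Set} (G : ColouredGraph n k) (f : Fin n → Fin n) →
    (∀ y → R (f y)) → (∀ y → Walk G (f y) y) → (∀ {a b} → Adj G a b → f a ≡ f b) →
    (∀ {x} → R x → f x ≡ x) → RootedBy R G
  rootedBy {R} G f f-root f-walk f-adj f-fix y = f y , (f-root y , f-walk y) , λ (rx , w) → trans (along w) (f-fix rx)
    where
      along : ∀ {a b} → Walk G a b → f b ≡ f a
      along ε       = refl
      along (e ◅ w) = trans (along w) (sym (f-adj e))

  module Root {R : Fin n → Set} (G : ColouredGraph n k) (rooted : RootedBy R G) where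

    root : Fin n → Fin n
    root y = proj₁ (rooted y)

    root-isRoot : ∀ y → R (root y)
    root-isRoot y = proj₁ (proj₁ (proj₂ (rooted y)))

    root-walk : ∀ y → Walk G (root y) y
    root-walk y = proj₂ (proj₁ (proj₂ (rooted y)))

    root-unique : ∀ {x y} → R x → Walk G x y → root y ≡ x
    root-unique {y = y} rx w = proj₂ (proj₂ (rooted y)) (rx , w)

    root-fix : ∀ {x} → R x → root x ≡ x
    root-fix rx = root-unique rx ε

    root-along : ∀ {a b} → Walk G a b → root a ≡ root b
    root-along {a} w = sym (root-unique (root-isRoot a) (root-walk a ◅◅ w))

    root-adj : ∀ {a b} → Adj G a b → root a ≡ root b
    root-adj e = root-along (e ◅ ε)

    separated : ∀ {a b} → root a ≢ root b → colour G a b ≡ nothing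
    separated {a} {b} ≢ with colour G a b in eq
    ... | nothing = refl
    ... | just c  = contradiction (root-adj (c , eq)) ≢

  -- One construction for both directions: `just c` joins `p` to `q`, while `nothing` deletes the
  -- edge and makes the condition on `m` vacuous.
  setEdge : (G : ColouredGraph n k) (p q : Fin n) → p ≢ q → (m : Maybe (Fin k)) →
    (∀ {c} → m ≡ just c → ∀ y → colour G p y ≢ just c × colour G q y ≢ just c) → ColouredGraph n k
  setEdge G p q p≢q m free = record
    { colour = col ; colour-sym = col-sym ; colour-irrefl = col-irrefl ; colour-proper = λ {x} → col-proper {x} }
    where
      open ColouredGraph G using (colour-sym; colour-irrefl; colour-proper)
      col = override p q m (colour G)
      col-sym : ∀ a b → col a b ≡ col b a
      col-sym a b with isEdge? p q a b
      ... | yes e = sym (override-edge m _ (IsEdge-sym e))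
      ... | no ¬e = trans (colour-sym a b) (sym (override-other m _ (¬e ∘ IsEdge-sym)))
      col-irrefl : ∀ a → col a a ≡ nothing
      col-irrefl a with isEdge? p q a a
      ... | yes (inj₁ (refl , eq)) = contradiction eq p≢q
      ... | yes (inj₂ (refl , eq)) = contradiction (sym eq) p≢q
      ... | no _                   = colour-irrefl a
      clash : ∀ {a y z c} → IsEdge p q a y → m ≡ just c → colour G a z ≡ just c → ⊥
      clash (inj₁ (refl , _)) m≡ eq = proj₁ (free m≡ _) eq
      clash (inj₂ (refl , _)) m≡ eq = proj₂ (free m≡ _) eq
      col-proper : ∀ {a y z c} → col a y ≡ just c → col a z ≡ just c → y ≡ z
      col-proper {a} {y} {z} e e′ with isEdge? p q a y | isEdge? p q a z
      ... | yes (inj₁ (_ , refl))    | yes (inj₁ (_ , refl))    = refl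
      ... | yes (inj₁ (refl , _))    | yes (inj₂ (eq , _))      = contradiction eq p≢q
      ... | yes (inj₂ (refl , _))    | yes (inj₁ (eq , _))      = contradiction (sym eq) p≢q
      ... | yes (inj₂ (_ , refl))    | yes (inj₂ (_ , refl))    = refl
      ... | yes i                    | no _                     = ⊥-elim (clash i e e′)
      ... | no _                     | yes i                    = ⊥-elim (clash i e′ e)
      ... | no _                     | no _                     = colour-proper e e′

  -- The Adj-invariant f witnesses that p and q lie in different components.
  module Bridge (G H : ColouredGraph n k) (p q : Fin n) (f : Fin n → Fin n)
    (new : ∀ {a b} → Adj H a b → Adj G a b ⊎ IsEdge p q a b)
    (f-adj : ∀ {a b} → Adj G a b → f a ≡ f b) (fp≢fq : f p ≢ f q) where

    f-along : ∀ {a b} → Walk G a b → f a ≡ f b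
    f-along ε       = refl
    f-along (e ◅ w) = trans (f-adj e) (f-along w)

    lift-avoiding-end : ∀ {z a b} → z ≡ p ⊎ z ≡ q → (w : Walk H a b) → z ∉ vertices H w → Lifted H G w
    lift-avoiding-end {z} z∈ w = lift-avoiding H G z (old z∈) w
      where
        old : ∀ {z a b} → z ≡ p ⊎ z ≡ q → a ≢ z → b ≢ z → Adj H a b → Adj G a b
        old z∈ a≢z b≢z e with new e | z∈
        ... | inj₁ e′                  | _         = e′
        ... | inj₂ (inj₁ (refl , _))   | inj₁ refl = contradiction refl a≢z
        ... | inj₂ (inj₁ (_ , refl))   | inj₂ refl = contradiction refl b≢z
        ... | inj₂ (inj₂ (_ , refl))   | inj₁ refl = contradiction refl b≢z
        ... | inj₂ (inj₂ (refl , _))   | inj₂ refl = contradiction refl a≢z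

    -- A path leaving an end of the new edge through that edge cannot come back to this end, so the
    -- rest of it lies in `G`. The edge is crossed at most once, and a path that crosses it ends on
    -- the other side.
    lift-or-cross : ∀ {a b} (w : Walk H a b) → IsPath H w → Lifted H G w ⊎ f a ≢ f b
    lift-or-cross ε _ = inj₁ (ε , refl)
    lift-or-cross (e ◅ w) u with cons-path H {e = e} {w = w} u | new e
    ... | a∉ , u′ | inj₁ e′ with lift-or-cross w u′
    ...   | inj₁ (w′ , eq) = inj₁ (e′ ◅ w′ , cong (_ ∷_) eq)
    ...   | inj₂ ≢         = inj₂ (≢ ∘ trans (sym (f-adj e′)))
    lift-or-cross (e ◅ w) u | a∉ , u′ | inj₂ (inj₁ (refl , refl)) =
      inj₂ λ eq → fp≢fq (trans eq (sym (f-along (proj₁ (lift-avoiding-end (inj₁ refl) w a∉)))))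
    lift-or-cross (e ◅ w) u | a∉ , u′ | inj₂ (inj₂ (refl , refl)) =
      inj₂ λ eq → fp≢fq (trans (f-along (proj₁ (lift-avoiding-end (inj₂ refl) w a∉))) (sym eq))

    -- If the path starts with a step of `G`, the rest avoids its starting point and hence the edge,
    -- so `G` would connect `p` and `q`. If it starts along the edge itself, it has already arrived
    -- and is too short.
    no-cycle-on-edge : ∀ {a b} (w : Walk H a b) → IsPath H w → 3 ≤ length (vertices H w) → ¬ IsEdge p q b a
    no-cycle-on-edge ε u (s≤s ()) _
    no-cycle-on-edge (e ◅ w) u 3≤ i with cons-path H {e = e} {w = w} u | new e
    no-cycle-on-edge (e ◅ w) u 3≤ (inj₁ (refl , refl)) | a∉ , u′ | inj₁ e′ =
      fp≢fq (sym (trans (f-adj e′) (f-along (proj₁ (lift-avoiding-end (inj₂ refl) w a∉)))))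
    no-cycle-on-edge (e ◅ w) u 3≤ (inj₂ (refl , refl)) | a∉ , u′ | inj₁ e′ =
      fp≢fq (trans (f-adj e′) (f-along (proj₁ (lift-avoiding-end (inj₁ refl) w a∉))))
    no-cycle-on-edge (e ◅ w) u 3≤ (inj₁ (refl , refl)) | a∉ , u′ | inj₂ (inj₁ (refl , refl)) = fp≢fq refl
    no-cycle-on-edge (e ◅ w) u 3≤ (inj₁ (refl , refl)) | a∉ , u′ | inj₂ (inj₂ (refl , refl)) =
      closed-path-short H w u′ 3≤
    no-cycle-on-edge (e ◅ w) u 3≤ (inj₂ (refl , refl)) | a∉ , u′ | inj₂ (inj₂ (refl , refl)) = fp≢fq refl
    no-cycle-on-edge (e ◅ w) u 3≤ (inj₂ (refl , refl)) | a∉ , u′ | inj₂ (inj₁ (refl , refl)) =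
      closed-path-short H w u′ 3≤

    bridge-acyclic : Acyclic G → Acyclic H
    bridge-acyclic acyc w u 3≤ e with new e
    ... | inj₂ i = no-cycle-on-edge w u 3≤ i
    ... | inj₁ e′ with lift-or-cross w u
    ...   | inj₂ ≢         = ≢ (sym (f-adj e′))
    ...   | inj₁ (w′ , eq) = acyc w′ (subst Unique (sym eq) u) (subst (3 ≤_) (cong length (sym eq)) 3≤) e′

  -- The colour map depends on the vertex but not along edges, which lets one tree be recoloured
  -- while the others keep their colours.
  recolour : (G : ColouredGraph n k) (σ : Fin n → Fin k → Fin k) → (∀ a {c d} → σ a c ≡ σ a d → c ≡ d) →
    (∀ {a b} → Adj G a b → σ a ≡ σ b) → ColouredGraph n k
  recolour G σ σ-inj σ-adj = record
    { colour = λ a b → Maybe.map (σ a) (colour G a b)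
    ; colour-sym = col-sym
    ; colour-irrefl = λ a → cong (Maybe.map (σ a)) (colour-irrefl a)
    ; colour-proper = λ {a} {y} {z} → col-proper {a} {y} {z} }
    where
      open ColouredGraph G using (colour-sym; colour-irrefl; colour-proper)
      col-sym : ∀ a b → Maybe.map (σ a) (colour G a b) ≡ Maybe.map (σ b) (colour G b a)
      col-sym a b rewrite colour-sym b a with colour G a b in eq
      ... | nothing = refl
      ... | just c  = cong (λ τ → just (τ c)) (σ-adj (c , eq))
      col-proper : ∀ {a y z d} → Maybe.map (σ a) (colour G a y) ≡ just d →
        Maybe.map (σ a) (colour G a z) ≡ just d → y ≡ z
      col-proper {a} {y} {z} e e′ with map-just (σ a) (colour G a y) e | map-just (σ a) (colour G a z) e′
      ... | _ , eq , q | _ , eq′ , q′ = colour-proper eq (trans eq′ (cong just (σ-inj a (trans q′ (sym q)))))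

-- The colour restriction at roots and free half-edges

≢last⇒label≤ : ∀ {k} {d : Fin (suc k)} → d ≢ fromℕ k → label d ≤ k
≢last⇒label≤ {k} {d} d≢ = ℕₚ.≤∧≢⇒< (ℕₚ.≤-pred (toℕ<n d)) λ eq → d≢ (toℕ-injective (trans eq (sym (toℕ-fromℕ k))))

label≤⇒≢last : ∀ {k} {d : Fin (suc k)} → label d ≤ k → d ≢ fromℕ k
label≤⇒≢last {k} d< refl = ℕₚ.<-irrefl (toℕ-fromℕ k) d<

module _ {n k r : ℕ} where

  module F = SpecialForest {n} {k} {r}

  module Roots (F : SpecialForest n k r) = Root (F.graph F) (F.rooted F)
  open Roots public using (root)

  -- The free half-edges of the overview: the colours that a new edge at `x` may have as far as `x`
  -- alone is concerned. The other end is dealt with by the colour exchange.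
  Free : SpecialForest n k r → Fin n × Fin k → Set
  Free F (x , c) = (∀ y → F.colour F x y ≢ just c) × (F.IsRoot F x → label c ≤ k ∸ 1)

  Adj-cong : (F G : SpecialForest n k r) → (∀ x y → F.colour F x y ≡ F.colour G x y) →
    ∀ {x y} → F.Adj F x y → F.Adj G x y
  Adj-cong F G F≈G (c , eq) = c , trans (sym (F≈G _ _)) eq

  -- One inclusion of edges suffices: the walk from the root in `F` is also a walk in `G`, where the
  -- root is unique.
  root-cong-Adj : (F G : SpecialForest n k r) → (∀ {x y} → F.Adj F x y → F.Adj G x y) → ∀ y → root F y ≡ root G y
  root-cong-Adj F G F⇒G y = sym (Roots.root-unique G (Roots.root-isRoot F y) (gmap id F⇒G (Roots.root-walk F y)))

  root-cong : (F G : SpecialForest n k r) → (∀ x y → F.colour F x y ≡ F.colour G x y) → ∀ y → root F y ≡ root G y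
  root-cong F G F≈G = root-cong-Adj F G (Adj-cong F G F≈G)

  Free-cong : (F G : SpecialForest n k r) → (∀ x y → F.colour F x y ≡ F.colour G x y) → ∀ {i} → Free F i → Free G i
  Free-cong F G F≈G (free , sp) = (λ y eq → free y (trans (F≈G _ _) eq)) , sp

-- Joining the tree at ρ to another tree, and cutting it off

module Join {n k s : ℕ} (ρ : Fin n) (ρ≡s : toℕ ρ ≡ s) where

  private
    -- There are `K` colours in all; `k` counts those allowed at roots, so the forbidden last colour
    -- is `fromℕ k`.
    K = suc k
    module F₁ = SpecialForest {n} {K} {suc s}
    module F₀ = SpecialForest {n} {K} {s}

  root⇒≢ρ : ∀ {x : Fin n} → label x ≤ s → x ≢ ρ
  root⇒≢ρ x< refl = ℕₚ.<-irrefl ρ≡s x<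

  root-weaken : ∀ {x : Fin n} → label x ≤ s → label x ≤ suc s
  root-weaken = ℕₚ.m≤n⇒m≤1+n

  root-strengthen : ∀ {x : Fin n} → label x ≤ suc s → x ≢ ρ → label x ≤ s
  root-strengthen {x} x≤ x≢ρ = ℕₚ.≤∧≢⇒< (ℕₚ.≤-pred x≤) λ eq → x≢ρ (toℕ-injective (trans eq (sym ρ≡s)))

  ρ-root : label ρ ≤ suc s
  ρ-root = s≤s (ℕₚ.≤-reflexive ρ≡s)

  -- The root ρ may not use the last colour, a child of x along a c-coloured edge may not reuse c:
  -- exchanging the two colours in the whole tree of ρ turns one restriction into the other.
  κ : Fin K → Fin n → Fin K → Fin K
  κ c z with z ≟ ρ
  ... | yes _ = transpose c (fromℕ k)
  ... | no _  = id

  κ-ρ : ∀ c {z} → z ≡ ρ → κ c z ≡ transpose c (fromℕ k)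
  κ-ρ c {z} z≡ρ with z ≟ ρ
  ... | yes _  = refl
  ... | no z≢ρ = contradiction z≡ρ z≢ρ

  κ-other : ∀ c {z} → z ≢ ρ → κ c z ≡ id
  κ-other c {z} z≢ρ with z ≟ ρ
  ... | yes z≡ρ = contradiction z≡ρ z≢ρ
  ... | no _    = refl

  κ-involutive : ∀ c z d → κ c z (κ c z d) ≡ d
  κ-involutive c z d with z ≟ ρ
  ... | yes _ = transpose-involutive c (fromℕ k) d
  ... | no _  = refl

  κ-injective : ∀ c z {d e} → κ c z d ≡ κ c z e → d ≡ e
  κ-injective c z = involutive⇒injective (κ c z) (κ-involutive c z)

  -- The effect of joining on roots: with `u` the root of `x`, the tree of `ρ` receives the root `u`
  -- and all other trees keep theirs.
  redirect : Fin n → Fin n → Fin n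
  redirect u z with z ≟ ρ
  ... | yes _ = u
  ... | no _  = z

  redirect-ρ : ∀ {u z} → z ≡ ρ → redirect u z ≡ u
  redirect-ρ {u} {z} z≡ρ with z ≟ ρ
  ... | yes _  = refl
  ... | no z≢ρ = contradiction z≡ρ z≢ρ

  redirect-other : ∀ {u z} → z ≢ ρ → redirect u z ≡ z
  redirect-other {u} {z} z≢ρ with z ≟ ρ
  ... | yes z≡ρ = contradiction z≡ρ z≢ρ
  ... | no _    = refl

  module Attach (F : SpecialForest n K (suc s)) (x : Fin n) (c : Fin K)
    (free : Free F (x , c)) (rx≢ρ : root F x ≢ ρ) where

    private module RF = Roots F

    x≢ρ : x ≢ ρ
    x≢ρ refl = rx≢ρ (RF.root-fix ρ-root)

    recoloured : ColouredGraph n K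
    recoloured = recolour (F₁.graph F) (λ a → κ c (root F a)) (λ a → κ-injective c (root F a))
      (cong (κ c) ∘ RF.root-adj)

    open ColouredGraph using (colour; Adj)

    x-misses : ∀ {d} → just c ≡ just d → ∀ y → colour recoloured x y ≢ just d
    x-misses refl y eq with map-just (κ c (root F x)) (F₁.colour F x y) eq
    ... | d , eq′ , q = proj₁ free y (trans eq′ (cong just (trans (sym (cong (λ f → f d) (κ-other c rx≢ρ))) q)))

    -- Colour `c` at `ρ` after the exchange would have been the last colour before it, which the
    -- root `ρ` cannot use.
    ρ-misses : ∀ {d} → just c ≡ just d → ∀ y → colour recoloured ρ y ≢ just d
    ρ-misses refl y eq with map-just (κ c (root F ρ)) (F₁.colour F ρ y) eq
    ... | d , eq′ , q = label≤⇒≢last (F₁.special F ρ-root eq′)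
      (κ-injective c ρ (trans (cong (λ z → κ c z d) (sym (RF.root-fix ρ-root)))
        (trans q (trans (sym (transpose-right c (fromℕ k))) (sym (cong (λ f → f (fromℕ k)) (κ-ρ c refl)))))))

    graph : ColouredGraph n K
    graph = setEdge recoloured x ρ x≢ρ (just c) λ eq y → x-misses eq y , ρ-misses eq y

    recoloured-Adj⁻ : ∀ {a b} → Adj recoloured a b → F₁.Adj F a b
    recoloured-Adj⁻ {a} {b} (d , eq) with map-just (κ c (root F a)) (F₁.colour F a b) eq
    ... | d′ , eq′ , _ = d′ , eq′

    graph-Adj⁻ : ∀ {a b} → Adj graph a b → F₁.Adj F a b ⊎ IsEdge x ρ a b
    graph-Adj⁻ {a} {b} (d , eq) with isEdge? x ρ a b
    ... | yes i = inj₂ i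
    ... | no _  = inj₁ (recoloured-Adj⁻ (d , eq))

    same-tree⇒not-edge : ∀ {a b} → root F a ≡ root F b → ¬ IsEdge x ρ a b
    same-tree⇒not-edge eq (inj₁ (refl , refl)) = rx≢ρ (trans eq (RF.root-fix ρ-root))
    same-tree⇒not-edge eq (inj₂ (refl , refl)) = rx≢ρ (trans (sym eq) (RF.root-fix ρ-root))

    graph-Adj⁺ : ∀ {a b} → F₁.Adj F a b → Adj graph a b
    graph-Adj⁺ {a} {b} (d , eq) = κ c (root F a) d ,
      trans (override-other (just c) _ (same-tree⇒not-edge (RF.root-adj (d , eq))))
        (cong (Maybe.map (κ c (root F a))) eq)

    forest : SpecialForest n K s
    forest = record
      { graph = graph
      ; acyclic = Bridge.bridge-acyclic (F₁.graph F) graph x ρ (root F) graph-Adj⁻ RF.root-adj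
          (λ eq → rx≢ρ (trans eq (RF.root-fix ρ-root))) (F₁.acyclic F)
      ; rooted = rootedBy graph (λ y → redirect (root F x) (root F y)) isRoot walk adj fix
      ; special = special }
      where
        isRoot : ∀ y → label (redirect (root F x) (root F y)) ≤ s
        isRoot y with root F y ≟ ρ
        ... | yes _ = root-strengthen (RF.root-isRoot x) rx≢ρ
        ... | no ≢ρ = root-strengthen (RF.root-isRoot y) ≢ρ
        walk : ∀ y → ColouredGraph.Walk graph (redirect (root F x) (root F y)) y
        walk y with root F y ≟ ρ
        ... | yes eq = gmap id graph-Adj⁺ (RF.root-walk x) ◅◅
                         ((c , override-edge {p = x} {ρ} (just c) _ (inj₁ (refl , refl))) ◅
                         subst (λ z → ColouredGraph.Walk graph z y) eq (gmap id graph-Adj⁺ (RF.root-walk y)))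
        ... | no _   = gmap id graph-Adj⁺ (RF.root-walk y)
        rρ : redirect (root F x) (root F ρ) ≡ redirect (root F x) (root F x)
        rρ = trans (redirect-ρ (RF.root-fix ρ-root)) (sym (redirect-other rx≢ρ))
        adj : ∀ {a b} → Adj graph a b → redirect (root F x) (root F a) ≡ redirect (root F x) (root F b)
        adj e with graph-Adj⁻ e
        ... | inj₁ e′                 = cong (redirect (root F x)) (RF.root-adj e′)
        ... | inj₂ (inj₁ (refl , refl)) = sym rρ
        ... | inj₂ (inj₂ (refl , refl)) = rρ
        fix : ∀ {z} → label z ≤ s → redirect (root F x) (root F z) ≡ z
        fix z≤ = trans (redirect-other λ eq → root⇒≢ρ z≤ (trans (sym rz) eq)) rz
          where rz = RF.root-fix (root-weaken z≤)
        special : ∀ {y b d} → label y ≤ s → colour graph y b ≡ just d → label d ≤ K ∸ 1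
        special {y} {b} {d} y≤ eq with isEdge? x ρ y b
        special y≤ refl | yes (inj₁ (refl , refl)) = proj₂ free (root-weaken y≤)
        special y≤ eq   | yes (inj₂ (refl , _))    = contradiction refl (root⇒≢ρ y≤)
        special {y} {b} y≤ eq | no _ with map-just (κ c (root F y)) (F₁.colour F y b) eq
        ... | d′ , eq′ , q rewrite RF.root-fix (root-weaken y≤) | κ-other c (root⇒≢ρ y≤) | q =
          F₁.special F (root-weaken y≤) eq′

    attached-edge : colour graph x ρ ≡ just c
    attached-edge = override-edge {p = x} {ρ} (just c) _ (inj₁ (refl , refl))

    attached-edge′ : colour graph ρ x ≡ just c
    attached-edge′ = override-edge {p = x} {ρ} (just c) _ (inj₂ (refl , refl))

    κ-x : ∀ d → κ c (root F x) d ≡ d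
    κ-x d = cong (λ f → f d) (κ-other c rx≢ρ)

    κ-at-ρ : ∀ d → κ c (root F ρ) d ≡ transpose c (fromℕ k) d
    κ-at-ρ d = cong (λ f → f d) (κ-ρ c (RF.root-fix ρ-root))

    κ-root : ∀ {y} → label y ≤ s → ∀ d → κ c (root F y) d ≡ d
    κ-root y≤ d = cong (λ f → f d) (κ-other c (root⇒≢ρ y≤ ∘ trans (sym (RF.root-fix (root-weaken y≤)))))

    recolourCell : Fin n × Fin K → Fin n × Fin K
    recolourCell (y , d) = y , κ c (root F y) d

    -- The new edge occupies `c` at both ends. At `x` this is the excluded half-edge; at `ρ` it is
    -- the image of the last colour, which was not free while `ρ` was a root. Hence exactly one free
    -- half-edge is lost.
    Free-attach⁺ : ∀ i → Free F i → i ≢ (x , c) → Free forest (recolourCell i)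
    Free-attach⁺ (y , d) (fr , sp) i≢ = fr′ , sp′
      where
        fr′ : ∀ b → colour graph y b ≢ just (κ c (root F y) d)
        fr′ b eq with isEdge? x ρ y b
        ... | yes (inj₁ (refl , _)) = i≢ (cong (x ,_) (trans (sym (κ-x d)) (sym (just-injective eq))))
        ... | yes (inj₂ (refl , _)) = label≤⇒≢last (sp ρ-root) (κ-injective c (root F ρ)
                (trans (sym (just-injective eq)) (sym (trans (κ-at-ρ (fromℕ k)) (transpose-right c (fromℕ k))))))
        ... | no _ with map-just (κ c (root F y)) (F₁.colour F y b) eq
        ...   | d′ , eq′ , q = fr b (trans eq′ (cong just (κ-injective c (root F y) q)))
        sp′ : label y ≤ s → label (κ c (root F y) d) ≤ k
        sp′ y≤ rewrite κ-root y≤ d = sp (root-weaken y≤)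

    Free-attach⁻ : ∀ i → Free forest i → Free F (recolourCell i) × recolourCell i ≢ (x , c)
    Free-attach⁻ (y , d) (fr , sp) = (fr′ , sp′) , i≢
      where
        fr′ : ∀ b → F₁.colour F y b ≢ just (κ c (root F y) d)
        fr′ b eq = fr b (trans (proj₂ (graph-Adj⁺ (_ , eq))) (cong just (κ-involutive c (root F y) d)))
        sp′ : label y ≤ suc s → label (κ c (root F y) d) ≤ k
        sp′ y≤ = [ at-ρ , other ]′ (toSum (y ≟ ρ))
          where
            other : y ≢ ρ → label (κ c (root F y) d) ≤ k
            other y≢ρ = subst (λ e → label e ≤ k) (sym (κ-root (root-strengthen y≤ y≢ρ) d)) (sp (root-strengthen y≤ y≢ρ))
            at-ρ : y ≡ ρ → label (κ c (root F y) d) ≤ k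
            -- Only `c` is exchanged into the last colour, and at `ρ` the new edge already occupies
            -- `c`.
            at-ρ refl = ≢last⇒label≤ λ eq → fr x (trans attached-edge′ (cong just
                (κ-injective c (root F ρ) (trans (κ-at-ρ c) (trans (transpose-left c (fromℕ k)) (sym eq))))))
        i≢ : recolourCell (y , d) ≢ (x , c)
        i≢ eq with cong proj₁ eq
        ... | refl = fr ρ (trans attached-edge (cong just (trans (sym (cong proj₂ eq)) (κ-x d))))

    Free-cardinality : ∀ {N} → HasCardinality (Sub (setoid (Fin n × Fin K)) (Free forest)) N →
      HasCardinality (Sub (setoid (Fin n × Fin K)) (Free F)) (suc N)
    Free-cardinality = Sub-insert-cardinality (≡-dec _≟_ _≟_) recolourCell
      (λ (y , d) → cong (y ,_) (κ-involutive c (root F y) d)) (x , c) free Free-attach⁺ Free-attach⁻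

  Attachable : SpecialForest n K (suc s) × (Fin n × Fin K) → Set
  Attachable (F , (x , c)) = Free F (x , c) × root F x ≢ ρ

  Attachment : Setoid 0ℓ 0ℓ
  Attachment = Sub (×-setoid (𝓔 n K (suc s)) (setoid (Fin n × Fin K))) Attachable

  open Setoid Attachment renaming (Carrier to Attachments; _≈_ to _≈ᵃ_) using () public
  open Setoid (𝓔 n K s) renaming (_≈_ to _≈₀_) using ()

  attach : Attachments → SpecialForest n K s
  attach ((F , (x , c)) , (free , rx≢ρ)) = Attach.forest F x c free rx≢ρ

  attach-cong : ∀ {u v} → u ≈ᵃ v → attach u ≈₀ attach v
  attach-cong {(F , (x , c)) , _} {(G , _) , _} (F≈G , refl) = override-cong x ρ (just c) λ a b →
    cong₂ (λ z → Maybe.map (κ c z)) (root-cong F G F≈G a) (F≈G a b)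

  -- If `x` and `y` differ, the edge from `ρ` to `y` is not the one added to `F`, so `y` is in the
  -- tree of `ρ` in `F`. But the walk in `G` from the root of `y` stays outside the tree of `ρ`, so
  -- all its edges belong to `F` as well and give `y` a root other than `ρ`.
  attach-parent : ∀ u v → attach u ≈₀ attach v → proj₁ (proj₂ (proj₁ u)) ≡ proj₁ (proj₂ (proj₁ v))
  attach-parent u@((F , (x , c)) , (free , rx≢ρ)) v@((G , (y , d)) , (free′ , ry≢ρ)) F≈G with x ≟ y
  ... | yes x≡y = x≡y
  ... | no x≢y  = contradiction (trans (sym Fy≡Gy) (trans (sym ρ-y) (RF.root-fix ρ-root))) ry≢ρ
    where
      module RF = Roots F
      module RG = Roots G
      module AF = Attach F x c free rx≢ρ
      module AG = Attach G y d free′ ry≢ρ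
      ρ-y : root F ρ ≡ root F y
      ρ-y with AF.graph-Adj⁻ (d , trans (F≈G ρ y) AG.attached-edge′)
      ... | inj₁ e                    = RF.root-adj e
      ... | inj₂ (inj₁ (eq , _))      = contradiction (sym eq) AF.x≢ρ
      ... | inj₂ (inj₂ (_ , eq))      = contradiction (sym eq) x≢y
      along : ∀ {a b} → F₁.Walk G a b → root G a ≢ ρ → root F a ≡ root F b
      along ε _ = refl
      along {a} (_◅_ {j = b} e w) ra≢ρ
        with AF.graph-Adj⁻ {a} {b} (proj₁ (AG.graph-Adj⁺ e) , trans (F≈G a b) (proj₂ (AG.graph-Adj⁺ {a} {b} e)))
      ... | inj₁ e′                   = trans (RF.root-adj e′) (along w (ra≢ρ ∘ trans (RG.root-adj e)))
      ... | inj₂ (inj₁ (_ , refl))    = contradiction (trans (RG.root-adj e) (RG.root-fix ρ-root)) ra≢ρ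
      ... | inj₂ (inj₂ (refl , _))    = contradiction (RG.root-fix ρ-root) ra≢ρ
      Fy≡Gy : root F y ≡ root G y
      Fy≡Gy = trans (sym (along (RG.root-walk y) (ry≢ρ ∘ trans (sym (RG.root-along (RG.root-walk y))))))
                (RF.root-fix (RG.root-isRoot y))

  attach-injective : ∀ {u v} → attach u ≈₀ attach v → u ≈ᵃ v
  attach-injective {u@((F , (x , c)) , (free , rx≢ρ))} {v@((G , (y , d)) , (free′ , ry≢ρ))} F≈G
    with attach-parent u v F≈G
  ... | refl with just-injective (trans (sym (Attach.attached-edge F x c free rx≢ρ))
                    (trans (F≈G x ρ) (Attach.attached-edge G x d free′ ry≢ρ)))
  ...   | refl = same , refl
    where
      module RF = Roots F
      module RG = Roots G
      module AF = Attach F x c free rx≢ρ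
      module AG = Attach G x c free′ ry≢ρ
      F⇒G : ∀ {a b} → F₁.Adj F a b → F₁.Adj G a b
      F⇒G {a} {b} e
        with AG.graph-Adj⁻ {a} {b} (proj₁ (AF.graph-Adj⁺ e) , trans (sym (F≈G a b)) (proj₂ (AF.graph-Adj⁺ {a} {b} e)))
      ... | inj₁ e′ = e′
      ... | inj₂ i  = contradiction i (AF.same-tree⇒not-edge (RF.root-adj e))
      same : ∀ a b → F₁.colour F a b ≡ F₁.colour G a b
      same a b with isEdge? x ρ a b
      ... | yes (inj₁ (refl , refl)) = trans (RF.separated λ eq → rx≢ρ (trans eq (RF.root-fix ρ-root)))
              (sym (RG.separated λ eq → ry≢ρ (trans eq (RG.root-fix ρ-root))))
      ... | yes (inj₂ (refl , refl)) = trans (RF.separated λ eq → rx≢ρ (trans (sym eq) (RF.root-fix ρ-root)))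
              (sym (RG.separated λ eq → ry≢ρ (trans (sym eq) (RG.root-fix ρ-root))))
      -- The recolouring depends on the trees, so it can be cancelled only once the roots in `F` and
      -- `G` are known to agree.
      ... | no ¬i = map-injective (κ-injective c (root F a)) (trans (sym (override-other (just c) _ ¬i))
              (trans (F≈G a b) (trans (override-other (just c) _ ¬i)
                (cong (λ z → Maybe.map (κ c z) (F₁.colour G a b)) (sym (root-cong-Adj F G F⇒G a))))))

  module Cut (F : SpecialForest n K s) (x : Fin n) (c : Fin K) (ρx : F₀.colour F ρ x ≡ just c)
    (w : F₀.Walk F x (root F ρ)) (ρ∉w : ρ ∉ F₀.vertices F w) where

    private module RF = Roots F
    open ColouredGraph using (colour; Adj; Walk)

    xρ : F₀.colour F x ρ ≡ just c
    xρ = trans (F₀.colour-sym F x ρ) ρx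

    x≢ρ : x ≢ ρ
    x≢ρ refl with trans (sym xρ) (F₀.colour-irrefl F ρ)
    ... | ()

    G : ColouredGraph n K
    G = setEdge (F₀.graph F) x ρ x≢ρ nothing λ ()

    G⇒F : ∀ {a b d} → colour G a b ≡ just d → F₀.colour F a b ≡ just d × ¬ IsEdge x ρ a b
    G⇒F {a} {b} eq with isEdge? x ρ a b
    ... | no ¬i = eq , ¬i

    G-sub : ∀ {a b} → Adj G a b → F₀.Adj F a b
    G-sub (d , eq) = d , proj₁ (G⇒F eq)

    F⇒G : ∀ {a b} → ¬ IsEdge x ρ a b → F₀.Adj F a b → Adj G a b
    F⇒G ¬i (d , eq) = d , trans (override-other nothing _ ¬i) eq

    walk-x : Walk G (root F ρ) x
    walk-x = reverseWalk G (proj₁ (lift-avoiding (F₀.graph F) G ρ keep w ρ∉w))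
      where
        keep : ∀ {a b} → a ≢ ρ → b ≢ ρ → F₀.Adj F a b → Adj G a b
        keep a≢ρ b≢ρ = F⇒G λ { (inj₁ (_ , eq)) → b≢ρ eq ; (inj₂ (eq , _)) → a≢ρ eq }

    -- A path of one step would be the deleted edge; a longer one would form a cycle of `F` together
    -- with it.
    no-return : ¬ Walk G ρ x
    no-return w′ with walk⇒path G w′
    ... | ε , _                  = x≢ρ refl
    ... | (d , eq) ◅ ε , _       = proj₂ (G⇒F eq) (inj₂ (refl , refl))
    ... | (e ◅ e′ ◅ w″) , u with lift G (F₀.graph F) G-sub (e ◅ e′ ◅ w″)
    ...   | p , eq = F₀.acyclic F p (subst Unique (sym eq) u)
              (subst (3 ≤_) (cong length (sym eq)) (s≤s (s≤s (vertices-nonempty G w″)))) (c , xρ)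

    root-ρ≢ρ : root F ρ ≢ ρ
    root-ρ≢ρ = root⇒≢ρ (RF.root-isRoot ρ)

    Reached : Fin n → Set
    Reached y = ∃[ z ] label z ≤ suc s × Walk G z y

    -- Each time the walk uses the deleted edge, it is restarted at the far end: `ρ` is now a root
    -- itself, and `x` is still reached from the old root by `walk-x`.
    reached-along : ∀ {a b} → F₀.Walk F a b → Reached a → Reached b
    reached-along ε r = r
    reached-along {a} (_◅_ {j = b} e w) (z , z≤ , v) with isEdge? x ρ a b
    ... | no ¬i                     = reached-along w (z , z≤ , v ◅◅ (F⇒G ¬i e ◅ ε))
    ... | yes (inj₁ (_ , refl))     = reached-along w (ρ , ρ-root , ε)
    ... | yes (inj₂ (_ , refl))     = reached-along w (root F ρ , root-weaken (RF.root-isRoot ρ) , walk-x)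

    reached : ∀ y → Reached y
    reached y = reached-along (RF.root-walk y) (root F y , root-weaken (RF.root-isRoot y) , ε)

    -- Together the two walks make `z` the root of `ρ` in `F`. As `walk-x` leads from there to `x`,
    -- the deleted edge would be bypassed.
    not-both : ∀ {y z} → Walk G ρ y → label z ≤ suc s → z ≢ ρ → Walk G z y → ⊥
    not-both {z = z} v z≤ z≢ρ w′ = no-return (v ◅◅ reverseWalk G w′ ◅◅
        subst (λ t → Walk G t x) ρ-tree walk-x)
      where
        ρ-tree : root F ρ ≡ z
        ρ-tree = RF.root-unique (root-strengthen z≤ z≢ρ) (gmap id G-sub (w′ ◅◅ reverseWalk G v))

    rooted : RootedBy (λ z → label z ≤ suc s) G
    rooted y with reached y
    ... | z , z≤ , v = z , (z≤ , v) , λ {z′} (z′≤ , v′) → unique z≤ v z′≤ v′ (z ≟ ρ) (z′ ≟ ρ)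
      where
        unique : ∀ {z z′} → label z ≤ suc s → Walk G z y → label z′ ≤ suc s → Walk G z′ y →
          Dec (z ≡ ρ) → Dec (z′ ≡ ρ) → z ≡ z′
        unique _  _ _   _  (yes refl) (yes refl) = refl
        unique _  v z′≤ v′ (yes refl) (no z′≢ρ)  = ⊥-elim (not-both v z′≤ z′≢ρ v′)
        unique z≤ v _   v′ (no z≢ρ)   (yes refl) = ⊥-elim (not-both v′ z≤ z≢ρ v)
        unique z≤ v z′≤ v′ (no z≢ρ)   (no z′≢ρ)  =
          trans (sym (RF.root-unique (root-strengthen z≤ z≢ρ) (gmap id G-sub v)))
                (RF.root-unique (root-strengthen z′≤ z′≢ρ) (gmap id G-sub v′))

    module RG = Root G rooted

    root-x≢ρ : RG.root x ≢ ρ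
    root-x≢ρ eq = root-ρ≢ρ (trans (sym (RG.root-unique (root-weaken (RF.root-isRoot ρ)) walk-x)) eq)

    H : ColouredGraph n K
    H = recolour G (λ a → κ c (RG.root a)) (λ a → κ-injective c (RG.root a)) (cong (κ c) ∘ RG.root-adj)

    G⇒H : ∀ {a b} → Adj G a b → Adj H a b
    G⇒H {a} (d , eq) = κ c (RG.root a) d , cong (Maybe.map (κ c (RG.root a))) eq

    H⇒G : ∀ {a b} → Adj H a b → Adj G a b
    H⇒G {a} {b} (d , eq) with map-just (κ c (RG.root a)) (colour G a b) eq
    ... | d′ , eq′ , _ = d′ , eq′

    forest : SpecialForest n K (suc s)
    forest = record
      { graph = H
      ; acyclic = Acyclic-pullback H (F₀.graph F) id id (λ {a} {b} e → G-sub {a} {b} (H⇒G {a} {b} e)) (F₀.acyclic F)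
      ; rooted = rootedBy H RG.root RG.root-isRoot (λ y → gmap id (λ {a} {b} → G⇒H {a} {b}) (RG.root-walk y))
          (λ {a} {b} e → RG.root-adj {a} {b} (H⇒G {a} {b} e)) RG.root-fix
      ; special = special }
      where
        special : ∀ {y b d} → label y ≤ suc s → colour H y b ≡ just d → label d ≤ k
        special {y} {b} y≤ eq with map-just (κ c (RG.root y)) (colour G y b) eq
        ... | d′ , eq′ , refl = subst (λ z → label (κ c z d′) ≤ k) (sym (RG.root-fix y≤))
            ([ at-ρ , other ]′ (toSum (y ≟ ρ)))
          where
            other : y ≢ ρ → label (κ c y d′) ≤ k
            other y≢ρ = subst (λ σ → label (σ d′) ≤ k) (sym (κ-other c y≢ρ))
              (F₀.special F (root-strengthen y≤ y≢ρ) (proj₁ (G⇒F eq′)))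
            -- Colour `c` at `ρ` belongs to the deleted edge alone, so no remaining edge at `ρ` is
            -- exchanged into the last colour.
            at-ρ : y ≡ ρ → label (κ c y d′) ≤ k
            at-ρ refl = subst (λ σ → label (σ d′) ≤ k) (sym (κ-ρ c refl)) (≢last⇒label≤ λ last →
              proj₂ (G⇒F eq′) (inj₂ (refl ,
              F₀.colour-proper F (trans (proj₁ (G⇒F eq′)) (cong just
                (involutive⇒injective (transpose c (fromℕ k)) (transpose-involutive c (fromℕ k))
                  (trans last (sym (transpose-left c (fromℕ k))))))) ρx)))

    free-x : Free forest (x , c)
    free-x = fr , λ x≤ → F₀.special F (root-strengthen x≤ x≢ρ) xρ
      where
        fr : ∀ y → colour H x y ≢ just c
        fr y eq with map-just (κ c (RG.root x)) (colour G x y) eq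
        ... | d , eq′ , q = proj₂ (G⇒F eq′) (inj₁ (refl , F₀.colour-proper F (trans (proj₁ (G⇒F eq′)) (cong just
                (trans (sym (cong (λ f → f d) (κ-other c root-x≢ρ))) q))) xρ))

    attachment : Attachments
    attachment = (forest , (x , c)) , (free-x , root-x≢ρ)

    attach-attachment : attach attachment ≈₀ F
    attach-attachment a b with isEdge? x ρ a b
    ... | yes (inj₁ (refl , refl)) = sym xρ
    ... | yes (inj₂ (refl , refl)) = sym ρx
    -- The root map of `forest` is `RG.root` by computation, so cutting and joining apply the same
    -- involution and it cancels.
    ... | no ¬i = trans (cong (Maybe.map (κ c (RG.root a)) ∘ Maybe.map (κ c (RG.root a))) (override-other nothing _ ¬i))
            (map-involutive (κ-involutive c (RG.root a)) (F₀.colour F a b))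
      where
        map-involutive : ∀ {σ : Fin K → Fin K} → (∀ d → σ (σ d) ≡ d) → ∀ m → Maybe.map σ (Maybe.map σ m) ≡ m
        map-involutive σσ nothing  = refl
        map-involutive σσ (just d) = cong just (σσ d)

  cut : ∀ F → Σ[ u ∈ Attachments ] attach u ≈₀ F
  cut F with first-step (F₀.graph F) (root⇒≢ρ (Roots.root-isRoot F ρ) ∘ sym)
               (reverseWalk (F₀.graph F) (Roots.root-walk F ρ))
  ... | x , c , ρx , w , ρ∉w = Cut.attachment F x c ρx w ρ∉w , Cut.attach-attachment F x c ρx w ρ∉w

  attach-inverse : Inverse Attachment (𝓔 n K s)
  attach-inverse = bijection⇒Inverse attach (proj₁ ∘ cut)
    (λ {u} {v} → attach-cong {u} {v}) (λ {u} {v} → attach-injective {u} {v}) (proj₂ ∘ cut)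

-- Counting forests and free half-edges

×-cardinality : ∀ {S : Setoid 0ℓ 0ℓ} {a m n} → HasCardinality S a →
  HasCardinality (×-setoid S (setoid (Fin m × Fin n))) (a ℕ.* (m ℕ.* n))
×-cardinality i = Symmetry.inverse *↔× ∘↔ Pointwise-≡↔≡ ∘↔ (i ×-inverse Symmetry.inverse *↔×)

cardinality-unique : ∀ {S : Setoid 0ℓ 0ℓ} {a b} → HasCardinality S a → HasCardinality S b → a ≡ b
cardinality-unique i j = ↔⇒≡ (j ∘↔ Symmetry.inverse i)

module _ {n k : ℕ} where

  Free? : ∀ {r} (F : SpecialForest n k r) i → Dec (Free F i)
  Free? {r} F (x , c) = all? (λ y → ¬? (Maybe-≡-dec _≟_ (SpecialForest.colour F x y) (just c)))
    ×-dec (label x ℕₚ.≤? r →-dec label c ℕₚ.≤? k ∸ 1)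

  colourless : (F : SpecialForest n k n) → ∀ x y → SpecialForest.colour F x y ≡ nothing
  colourless F x y with x ≟ y
  ... | yes refl = SpecialForest.colour-irrefl F x
  ... | no x≢y   = Roots.separated F λ eq →
      x≢y (trans (sym (Roots.root-fix F (toℕ<n x))) (trans eq (Roots.root-fix F (toℕ<n y))))

  edgeless : SpecialForest n k n
  edgeless = record
    { graph = G
    ; acyclic = λ _ _ _ ()
    ; rooted = rootedBy G id toℕ<n (λ _ → ε) (λ ()) (λ _ → refl)
    ; special = λ _ () }
    where
      G : ColouredGraph n k
      G = record
        { colour = λ _ _ → nothing ; colour-sym = λ _ _ → refl
        ; colour-irrefl = λ _ → refl ; colour-proper = λ () }

module _ {n k : ℕ} where

  private K = suc k

  -- Induction on the number `j` of edges. Each further edge replaces forests by pairs of a forest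
  -- and a half-edge under a decidable condition, which preserves finiteness.
  forests-finite : ∀ j r → j ℕ.+ r ≡ n → ∃[ m ] HasCardinality (𝓔 n K r) m
  forests-finite zero r refl = 1 , bijection⇒Inverse (λ _ → zero) (λ _ → edgeless) (λ _ → refl)
    (λ {F} {G} _ x y → trans (colourless F x y) (sym (colourless G x y))) (λ { zero → refl })
  forests-finite (suc j) s eq with forests-finite j (suc s) (trans (ℕₚ.+-suc j s) eq)
  ... | m , i = _ , proj₂ attachments-finite ∘↔ Symmetry.inverse attach-inverse
    where
      s<n : s < n
      s<n = subst (suc s ≤_) eq (s≤s (ℕₚ.m≤n+m s j))
      open Join {k = k} (fromℕ< s<n) (toℕ-fromℕ< s<n)
      attachments-finite : ∃[ c ] HasCardinality Attachment c
      attachments-finite = Sub-finite (×-cardinality i)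
        (λ (F , (x , c)) → Free? F (x , c) ×-dec ¬? (root F x ≟ fromℕ< s<n))
        λ { {F , _} {G , _} (F≈G , refl) (free , x≢) →
            Free-cong F G F≈G free , x≢ ∘ trans (root-cong F G F≈G _) }

  -- Every vertex offers k + 1 colours, each root loses one, and each of the n − r edges uses up two.
  FreeCount : ℕ → ℕ → Set
  FreeCount r N = N ℕ.+ 2 ℕ.* n ≡ K ℕ.* n ℕ.+ r

  Cell : Setoid 0ℓ 0ℓ
  Cell = setoid (Fin n × Fin K)

  -- If all vertices are roots, each offers the `k` colours below the last. Otherwise `F` arises by
  -- joining from a forest with one edge less, which has exactly one more free half-edge.
  free-cardinality : ∀ j r → j ℕ.+ r ≡ n → (F : SpecialForest n K r) →
    ∃[ N ] HasCardinality (Sub Cell (Free F)) N × FreeCount r N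
  free-cardinality zero r refl F = n ℕ.* k ,
    Symmetry.inverse *↔× ∘↔ bijection⇒Inverse f g (λ {u} {v} → f-cong {u} {v}) (λ {u} {v} → f-inj {u} {v}) fg ,
    count
    where
      f : Σ (Fin n × Fin K) (Free F) → Fin n × Fin k
      f ((x , c) , _ , sp) = x , fromℕ< (sp (toℕ<n x))
      g : Fin n × Fin k → Σ (Fin n × Fin K) (Free F)
      g (x , c) = (x , inject₁ c) , (λ y eq → case trans (sym (colourless F x y)) eq of λ ()) ,
                  λ _ → subst (_≤ k) (cong suc (sym (toℕ-inject₁ c))) (toℕ<n c)
      f-cong : ∀ {u v} → proj₁ u ≡ proj₁ v → f u ≡ f v
      f-cong {(x , c) , _} refl = cong (x ,_) (fromℕ<-cong _ _ refl _ _)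
      f-inj : ∀ {u v} → f u ≡ f v → proj₁ u ≡ proj₁ v
      f-inj eq = cong₂ _,_ (cong proj₁ eq) (toℕ-injective (fromℕ<-injective _ _ _ _ (cong proj₂ eq)))
      fg : ∀ v → f (g v) ≡ v
      fg (x , c) = cong (x ,_) (toℕ-injective (trans (toℕ-fromℕ< _) (toℕ-inject₁ c)))
      count : n ℕ.* k ℕ.+ 2 ℕ.* n ≡ K ℕ.* n ℕ.+ n
      count = solve 2 (λ n k → n :* k :+ con 2 :* n := (con 1 :+ k) :* n :+ n) refl n k
        where open ℕ-Solver.+-*-Solver using (solve; _:*_; _:+_; con; _:=_)
  free-cardinality (suc j) s eq F = m ,
    i ∘↔ Sub-cong (Identity.inverse Cell) (λ _ → Free-cong F F′ (λ x y → sym (F′≈F x y)))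
      (λ _ → Free-cong F′ F F′≈F) (λ { refl p → p }) , count
    where
      s<n : s < n
      s<n = subst (suc s ≤_) eq (s≤s (ℕₚ.m≤n+m s j))
      open Join {k = k} (fromℕ< s<n) (toℕ-fromℕ< s<n)
      u = proj₁ (cut F)
      F′ = attach u
      F′≈F = proj₂ (cut F)
      F₁ = proj₁ (proj₁ u)
      -- `Free-cardinality` leads from the joined forest back to the earlier one, against the
      -- direction of the induction. So `m` is first obtained from decidability and then identified
      -- by uniqueness of cardinalities.
      free-finite : ∃[ m ] HasCardinality (Sub Cell (Free F′)) m
      free-finite = Sub-finite (Symmetry.inverse *↔×) (Free? F′) (λ { refl p → p })
      m = proj₁ free-finite
      i = proj₂ free-finite
      IH = free-cardinality j (suc s) (trans (ℕₚ.+-suc j s) eq) F₁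
      suc-m : proj₁ IH ≡ suc m
      suc-m = cardinality-unique (proj₁ (proj₂ IH))
        (Attach.Free-cardinality F₁ _ _ (proj₁ (proj₂ u)) (proj₂ (proj₂ u)) i)
      count : FreeCount s m
      count = ℕₚ.suc-injective (trans (cong (ℕ._+ 2 ℕ.* n) (sym suc-m))
        (trans (proj₂ (proj₂ IH)) (ℕₚ.+-suc (K ℕ.* n) s)))

-- Exchanging the trees of two roots

module Relabel {n k r : ℕ} (τ : Fin n → Fin n) (τ-involutive : ∀ x → τ (τ x) ≡ x)
  (τ-root : ∀ {x} → label x ≤ r → label (τ x) ≤ r) where

  private
    module 𝓕 = SpecialForest {n} {k} {r}

  relabel : SpecialForest n k r → SpecialForest n k r
  relabel F = record
    { graph = G
    ; acyclic = Acyclic-pullback G (𝓕.graph F) τ (involutive⇒injective τ τ-involutive) id (𝓕.acyclic F)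
    ; rooted = rootedBy G (λ y → τ (root F (τ y))) (λ y → τ-root (RF.root-isRoot (τ y)))
        (λ y → subst (ColouredGraph.Walk G _) (τ-involutive y) (gmap τ (λ {a} {b} → pull {a} {b}) (RF.root-walk (τ y))))
        (cong τ ∘ RF.root-adj) (λ x≤ → trans (cong τ (RF.root-fix (τ-root x≤))) (τ-involutive _))
    ; special = λ x≤ → 𝓕.special F (τ-root x≤) }
    where
      module RF = Roots F
      G : ColouredGraph n k
      G = record
        { colour = λ a b → 𝓕.colour F (τ a) (τ b)
        ; colour-sym = λ a b → 𝓕.colour-sym F (τ a) (τ b)
        ; colour-irrefl = λ a → 𝓕.colour-irrefl F (τ a)
        ; colour-proper = λ e e′ → involutive⇒injective τ τ-involutive (𝓕.colour-proper F e e′) }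
      pull : ∀ {a b} → 𝓕.Adj F a b → ColouredGraph.Adj G (τ a) (τ b)
      pull {a} {b} (c , eq) = c , trans (cong₂ (𝓕.colour F) (τ-involutive a) (τ-involutive b)) eq

  relabel-involutive : ∀ F x y → 𝓕.colour (relabel (relabel F)) x y ≡ 𝓕.colour F x y
  relabel-involutive F x y = cong₂ (𝓕.colour F) (τ-involutive x) (τ-involutive y)

  Free-relabel : ∀ F {x c} → Free F (x , c) → Free (relabel F) (τ x , c)
  Free-relabel F {x} (free , sp) =
    (λ y eq → free (τ y) (trans (cong (λ z → 𝓕.colour F z (τ y)) (sym (τ-involutive x))) eq)) ,
    (λ x≤ → sp (subst (λ z → label z ≤ r) (τ-involutive x) (τ-root x≤)))

  Marked : Setoid 0ℓ 0ℓ
  Marked = ×-setoid (𝓔 n k r) (setoid (Fin n × Fin k))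

  open Setoid Marked using (_≈_) renaming (Carrier to Markeds; trans to ≈-trans; sym to ≈-sym)

  relabelMarked : Markeds → Markeds
  relabelMarked (F , (x , c)) = relabel F , (τ x , c)

  relabelMarked-cong : ∀ {u v} → u ≈ v → relabelMarked u ≈ relabelMarked v
  relabelMarked-cong (F≈G , refl) = (λ x y → F≈G (τ x) (τ y)) , refl

  relabelMarked-involutive : ∀ u → relabelMarked (relabelMarked u) ≈ u
  relabelMarked-involutive (F , (x , c)) = relabel-involutive F , cong (_, c) (τ-involutive x)

  relabelMarked-injective : ∀ {u v} → relabelMarked u ≈ relabelMarked v → u ≈ v
  relabelMarked-injective {u} {v} eq = ≈-trans {u} {u″} {v} (≈-sym {u″} {u} (relabelMarked-involutive u))
    (≈-trans {u″} {v″} {v} (relabelMarked-cong {relabelMarked u} {relabelMarked v} eq) (relabelMarked-involutive v))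
    where
      u″ = relabelMarked (relabelMarked u)
      v″ = relabelMarked (relabelMarked v)

-- Descendants of 1 in terms of roots

module _ {n k r : ℕ} (1≤r : 1 ≤ r) (F : SpecialForest (suc n) k r) where

  private module RF = Roots F

  -- Vertex 1 is itself a root and lies on a walk from the root of the last vertex, so uniqueness of
  -- roots identifies the two.
  n≺1⇒root : n≺1 F → root F (fromℕ n) ≡ zero
  n≺1⇒root (y , x , y≡ , x≡ , σ , w , σ≤ , _ , x∈) =
    trans (cong (root F) (toℕ-injective (trans (toℕ-fromℕ n) (sym (ℕₚ.suc-injective y≡)))))
      (trans (RF.root-unique σ≤ w) (trans (sym (RF.root-unique σ≤ (prefix G w x∈)))
        (trans (RF.root-fix (subst (_≤ r) (sym x≡) 1≤r)) (toℕ-injective (ℕₚ.suc-injective x≡)))))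
    where G = SpecialForest.graph F

  root⇒n≺1 : root F (fromℕ n) ≡ zero → n≺1 F
  root⇒n≺1 eq with walk⇒path (SpecialForest.graph F) (RF.root-walk (fromℕ n))
  ... | w , path = fromℕ n , zero , cong suc (toℕ-fromℕ n) , refl , root F (fromℕ n) , w , RF.root-isRoot _ , path ,
          subst (_∈ ColouredGraph.vertices (SpecialForest.graph F) w) eq (start∈vertices (SpecialForest.graph F) w)

-- If x lies in the tree of ρ, exchanging the roots 1 and ρ brings x into the tree of 1 and n into the tree
-- of ρ; joining ρ to x then puts n below 1 again.
module Exchange {n k s : ℕ} (ρ : Fin (suc n)) (ρ≡s : toℕ ρ ≡ s) (1≤s : 1 ≤ s) (s<n : s < n) where

  private
    K = suc k
    ℓ = fromℕ n

  open Join {suc n} {k} ρ ρ≡s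

  ρ≢0 : ρ ≢ zero
  ρ≢0 refl = ℕₚ.<⇒≢ 1≤s ρ≡s

  -- The last vertex has to stay in place when the roots are exchanged; `s<n` separates it from both
  -- of them.
  ℓ≢ρ : ℓ ≢ ρ
  ℓ≢ρ refl = ℕₚ.<⇒≢ s<n (trans (sym ρ≡s) (toℕ-fromℕ n))

  ℓ≢0 : ℓ ≢ zero
  ℓ≢0 eq = ℕₚ.<⇒≢ (ℕₚ.≤-<-trans z≤n s<n) (trans (cong toℕ (sym eq)) (toℕ-fromℕ n))

  τ : Fin (suc n) → Fin (suc n)
  τ = transpose zero ρ

  τ-root : ∀ {x} → label x ≤ suc s → label (τ x) ≤ suc s
  τ-root {x} x≤ with toSum (x ≟ zero) | toSum (x ≟ ρ)
  ... | inj₁ refl | _         = subst (λ z → label z ≤ suc s) (sym (transpose-left zero ρ)) ρ-root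
  ... | inj₂ _    | inj₁ refl = subst (λ z → label z ≤ suc s) (sym (transpose-right zero ρ)) (s≤s z≤n)
  ... | inj₂ x≢0  | inj₂ x≢ρ  = subst (λ z → label z ≤ suc s) (sym (transpose-other zero ρ x≢0 x≢ρ)) x≤

  open Relabel {suc n} {K} {suc s} τ (transpose-involutive zero ρ) τ-root
  open Setoid Marked using (_≈_) renaming (Carrier to Markeds; trans to ≈-trans; refl to ≈-refl)

  root-τ : ∀ F x → root (relabel F) (τ x) ≡ τ (root F x)
  root-τ F x = cong (τ ∘ root F) (transpose-involutive zero ρ x)

  root-τ-ℓ : ∀ F → root (relabel F) ℓ ≡ τ (root F ℓ)
  root-τ-ℓ F = cong (τ ∘ root F) (transpose-other zero ρ ℓ≢0 ℓ≢ρ)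

  τρ : τ ρ ≡ zero
  τρ = transpose-right zero ρ

  Source : Setoid 0ℓ 0ℓ
  Source = Sub (×-setoid (𝓔[n≺1] (suc n) K (suc s)) (setoid (Fin (suc n) × Fin K))) λ ((F , _) , i) → Free F i

  Target : Setoid 0ℓ 0ℓ
  Target = Sub Attachment (n≺1 ∘ attach)

  private
    module S = Setoid Source
    module T = Setoid Target

  source-marked : S.Carrier → Markeds
  source-marked (((F , _) , i) , _) = F , i

  target-marked : T.Carrier → Markeds
  target-marked ((u , _) , _) = u

  rootAt : Markeds → Fin (suc n)
  rootAt (F , (x , _)) = root F x

  rootℓ : Markeds → Fin (suc n)
  rootℓ (F , _) = root F ℓ

  rootAt-cong : ∀ {u v} → u ≈ v → rootAt u ≡ rootAt v
  rootAt-cong {F , (x , _)} {G , _} (F≈G , refl) = root-cong F G F≈G x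

  rootℓ-cong : ∀ {u v} → u ≈ v → rootℓ u ≡ rootℓ v
  rootℓ-cong {F , _} {G , _} (F≈G , _) = root-cong F G F≈G ℓ

  source-rootℓ : ∀ u → rootℓ (source-marked u) ≡ zero
  source-rootℓ (((F , q) , _) , _) = n≺1⇒root (s≤s z≤n) F q

  -- The decision is an argument, so that the lemmas about `exchange` can split on it without
  -- unfolding a test.
  exchange : ∀ u → Dec (rootAt (source-marked u) ≡ ρ) → T.Carrier
  exchange u@(((F , q) , (x , c)) , free) (no x≢ρ) = v ,
    root⇒n≺1 1≤s (attach v) (trans (redirect-other (ρ≢0 ∘ sym ∘ trans (sym (source-rootℓ u)))) (source-rootℓ u))
    where
      v : Attachments
      v = (F , (x , c)) , (free , x≢ρ)
  exchange u@(((F , q) , (x , c)) , free) (yes x≡ρ) =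
    v , root⇒n≺1 1≤s (attach v) (trans (redirect-ρ ℓ≡ρ) x≡0)
    where
      x≡0 : root (relabel F) (τ x) ≡ zero
      x≡0 = trans (root-τ F x) (trans (cong τ x≡ρ) τρ)
      v : Attachments
      v = (relabel F , (τ x , c)) , (Free-relabel F free , λ eq → ρ≢0 (trans (sym eq) x≡0))
      ℓ≡ρ : root (relabel F) ℓ ≡ ρ
      ℓ≡ρ = trans (root-τ-ℓ F) (trans (cong τ (source-rootℓ u)) (transpose-left zero ρ))

  -- Which case of `exchange` occurred is visible afterwards from the tree of the last vertex: it
  -- hangs at 1 if nothing was exchanged and at `ρ` otherwise.
  exchange⁻¹ : ∀ u → Dec (rootℓ (target-marked u) ≡ ρ) → S.Carrier
  exchange⁻¹ u@(((F , (x , c)) , (free , x≢ρ)) , q) (no ℓ≢ρ) =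
    ((F , root⇒n≺1 (s≤s z≤n) F (trans (sym (redirect-other ℓ≢ρ)) (n≺1⇒root 1≤s (attach (proj₁ u)) q))) , (x , c)) , free
  exchange⁻¹ u@(((F , (x , c)) , (free , x≢ρ)) , q) (yes ℓ≡ρ) =
    ((relabel F , root⇒n≺1 (s≤s z≤n) (relabel F) (trans (root-τ-ℓ F) (trans (cong τ ℓ≡ρ) τρ))) , (τ x , c)) ,
    Free-relabel F free

  rootℓ-relabelled : ∀ u → rootℓ (relabelMarked (source-marked u)) ≡ ρ
  rootℓ-relabelled u = trans (root-τ-ℓ (proj₁ (source-marked u)))
    (trans (cong τ (source-rootℓ u)) (transpose-left zero ρ))

  exchange-cong : ∀ u v d e → source-marked u ≈ source-marked v → exchange u d T.≈ exchange v e
  exchange-cong u v (yes _)   (yes _)   eq = relabelMarked-cong {source-marked u} {source-marked v} eq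
  exchange-cong u v (no _)    (no _)    eq = eq
  exchange-cong u v (yes x≡ρ) (no y≢ρ)  eq =
    contradiction (trans (sym (rootAt-cong {source-marked u} {source-marked v} eq)) x≡ρ) y≢ρ
  exchange-cong u v (no x≢ρ)  (yes y≡ρ) eq =
    contradiction (trans (rootAt-cong {source-marked u} {source-marked v} eq) y≡ρ) x≢ρ

  exchange-injective : ∀ u v d e → exchange u d T.≈ exchange v e → source-marked u ≈ source-marked v
  exchange-injective u v (yes _) (yes _) eq = relabelMarked-injective {source-marked u} {source-marked v} eq
  exchange-injective u v (no _)  (no _)  eq = eq
  exchange-injective u v (yes _) (no _)  eq = contradiction
    (trans (sym (rootℓ-relabelled u))
      (trans (rootℓ-cong {relabelMarked (source-marked u)} {source-marked v} eq) (source-rootℓ v))) ρ≢0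
  exchange-injective u v (no _)  (yes _) eq = contradiction
    (trans (sym (rootℓ-relabelled v))
      (trans (sym (rootℓ-cong {source-marked u} {relabelMarked (source-marked v)} eq)) (source-rootℓ u))) ρ≢0

  exchange-exchange⁻¹ : ∀ u d e → exchange (exchange⁻¹ u d) e T.≈ u
  exchange-exchange⁻¹ u (yes _) (yes _) = relabelMarked-involutive (target-marked u)
  exchange-exchange⁻¹ u (no _)  (no _)  = ≈-refl {target-marked u}
  exchange-exchange⁻¹ u@((_ , (_ , x≢ρ)) , _) (no _) (yes x≡ρ) = contradiction x≡ρ x≢ρ
  exchange-exchange⁻¹ u@(((F , (x , c)) , (free , x≢ρ)) , q) (yes ℓ≡ρ) (no τx≢ρ) = contradiction
    (trans (root-τ F x) (trans (cong τ x≡0) (transpose-left zero ρ))) τx≢ρ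
    where
      x≡0 : root F x ≡ zero
      x≡0 = trans (sym (redirect-ρ ℓ≡ρ)) (n≺1⇒root 1≤s (attach (proj₁ u)) q)

  rootAt? : ∀ u → Dec (rootAt (source-marked u) ≡ ρ)
  rootAt? u = rootAt (source-marked u) ≟ ρ

  rootℓ? : ∀ u → Dec (rootℓ (target-marked u) ≡ ρ)
  rootℓ? u = rootℓ (target-marked u) ≟ ρ

  exchange-inverse : Inverse Source Target
  exchange-inverse = bijection⇒Inverse (λ u → exchange u (rootAt? u)) (λ u → exchange⁻¹ u (rootℓ? u))
    (λ {u} {v} → exchange-cong u v (rootAt? u) (rootAt? v))
    (λ {u} {v} → exchange-injective u v (rootAt? u) (rootAt? v))
    (λ u → exchange-exchange⁻¹ u (rootℓ? u) (rootAt? (exchange⁻¹ u (rootℓ? u))))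

  n≺1-cong : ∀ {r} → 1 ≤ r → ∀ {F G : SpecialForest (suc n) K r} →
    (∀ x y → SpecialForest.colour F x y ≡ SpecialForest.colour G x y) → n≺1 F → n≺1 G
  n≺1-cong 1≤r {F} {G} F≈G q = root⇒n≺1 1≤r G (trans (sym (root-cong F G F≈G ℓ)) (n≺1⇒root 1≤r F q))

  source-inverse : Inverse (𝓔[n≺1] (suc n) K s) Source
  source-inverse = Symmetry.inverse
    (Sub-cong attach-inverse (λ _ q → q) (λ _ q → q) (λ {F} {G} → n≺1-cong 1≤s {F} {G}) ∘↔ exchange-inverse)

theorem5p1 : (k n r : ℕ) → 1 ≤ k → 2 ≤ r → r ≤ n ∸ 1 →
    ∃[ a ] ∃[ b ] (HasCardinality (𝓔[n≺1] n k (r ∸ 1)) a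
    × HasCardinality (𝓔[n≺1] n k r) b
    × + a ≡ (+ k * + n - + 2 * + n + + r) * + b)
theorem5p1 (suc k) (suc n) (suc s) _ (s≤s 1≤s) s<n =
  b ℕ.* N , b , source-cardinality ∘↔ source-inverse , b-card , count b b-card
  where
    K = suc k
    s<1+n : s < suc n
    s<1+n = ℕₚ.m≤n⇒m≤1+n s<n
    open Exchange {n} {k} (fromℕ< s<1+n) (toℕ-fromℕ< s<1+n) 1≤s s<n
    j = suc n ∸ suc s
    j+r≡n : j ℕ.+ suc s ≡ suc n
    j+r≡n = ℕₚ.m∸n+n≡m s<1+n
    N = K ℕ.* suc n ℕ.+ suc s ∸ 2 ℕ.* suc n

    finite : ∃[ b ] HasCardinality (𝓔[n≺1] (suc n) K (suc s)) b
    finite = Sub-finite (proj₂ (forests-finite j (suc s) j+r≡n))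
      (λ F → map′ (root⇒n≺1 (s≤s z≤n) F) (n≺1⇒root (s≤s z≤n) F) (root F (fromℕ n) ≟ zero))
      (λ {F} {G} → n≺1-cong (s≤s z≤n) {F} {G})
    b = proj₁ finite
    b-card = proj₂ finite

    fibre : ∀ F → HasCardinality (Sub Cell (Free F)) N
    fibre F with free-cardinality j (suc s) j+r≡n F
    ... | M , i , eq = subst (HasCardinality _) (trans (sym (ℕₚ.m+n∸n≡m M (2 ℕ.* suc n))) (cong (_∸ 2 ℕ.* suc n) eq)) i

    source-cardinality : HasCardinality Source (b ℕ.* N)
    source-cardinality = Sub-×-cardinality {P = Free ∘ proj₁} b-card
      (λ {u} {v} F≈G → Free-cong (proj₁ u) (proj₁ v) F≈G) (λ (F , _) → fibre F)

    -- The forest certifies that the subtraction in `N` is not truncated.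
    N+2n : SpecialForest (suc n) K (suc s) → N ℕ.+ 2 ℕ.* suc n ≡ K ℕ.* suc n ℕ.+ suc s
    N+2n F with free-cardinality j (suc s) j+r≡n F
    ... | M , _ , eq = ℕₚ.m∸n+n≡m (subst (2 ℕ.* suc n ≤_) eq (ℕₚ.m≤n+m _ M))

    +N : N ℕ.+ 2 ℕ.* suc n ≡ K ℕ.* suc n ℕ.+ suc s → + N ≡ + K * + suc n - + 2 * + suc n + + suc s
    +N eq = begin
      + N ≡⟨ solveℤ 2 (λ x y → x := x :+ y :- y) refl (+ N) (+ 2 * + suc n) ⟩
      + N + + 2 * + suc n - + 2 * + suc n ≡⟨ cong (λ z → + N + z - + 2 * + suc n) (ℤₚ.pos-* 2 (suc n)) ⟨
      + (N ℕ.+ 2 ℕ.* suc n) - + 2 * + suc n ≡⟨ cong (λ z → + z - + 2 * + suc n) eq ⟩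
      + (K ℕ.* suc n) + + suc s - + 2 * + suc n ≡⟨ cong (λ z → z + + suc s - + 2 * + suc n) (ℤₚ.pos-* K (suc n)) ⟩
      + K * + suc n + + suc s - + 2 * + suc n
        ≡⟨ solveℤ 3 (λ x y z → x :+ y :- z := x :- z :+ y) refl (+ K * + suc n) (+ suc s) (+ 2 * + suc n) ⟩
      + K * + suc n - + 2 * + suc n + + suc s ∎
      where
        open ≡-Reasoning
        open ℤ-Solver.+-*-Solver using (_:+_; _:-_; _:=_) renaming (solve to solveℤ)

    count : ∀ b → HasCardinality (𝓔[n≺1] (suc n) K (suc s)) b →
      + (b ℕ.* N) ≡ (+ K * + suc n - + 2 * + suc n + + suc s) * + b
    -- Without a forest to appeal to, `N` may be a truncated value, but both sides vanish. A
    -- positive cardinality yields a forest, the preimage of `zero`.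
    count zero    _ = sym (ℤₚ.*-zeroʳ (+ K * + suc n - + 2 * + suc n + + suc s))
    count (suc b) i = trans (ℤₚ.pos-* (suc b) N) (trans (ℤₚ.*-comm (+ suc b) (+ N))
      (cong (_* + suc b) (+N (N+2n (proj₁ (Inverse.from i zero))))))
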